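{- Let $x_1=(0,1)$, $b_1=2$ and $l_1=0$. For $i\ge2$, let $x_i=C_{i,i^2}$, $b_i=i$ and $l_i=i^{3i}$. Let $L_i=\sum_{j=1}^i l_j|x_j|$ (with $L_0=0$), let $q_n=b_i$ for $L_{i-1}<n\le L_i$, $Q=\{q_n\}_{n=1}^\infty$, let $(E_1,E_2,\ldots)=l_1x_1\,l_2x_2\,l_3x_3\ldots$, and let $x=\sum_{n=1}^\infty\frac{E_n}{q_1q_2\cdots q_n}$. Then $x$ is $Q$-normal.
   Context: A block of length $k$ in base $b$ is an ordered $k$-tuple of integers in $\{0,1,\ldots,b-1\}$; a block is a block of some length in some base. $|B|$ is the length of $B$. For blocks $B_1,B_2,\ldots$ and non-negative integers $l_1,l_2,\ldots$, $l_1B_1\,l_2B_2\ldots$ denotes the concatenation of $l_1$ copies of $B_1$, then $l_2$ copies of $B_2$, and so on. $C_{b,w}$ is the block formed by concatenating all $b^w$ blocks of length $w$ in base $b$ in lexicographic order (so $|C_{b,w}|=wb^w$); e.g. $C_{3,2}=(0,0,0,1,0,2,1,0,1,1,1,2,2,0,2,1,2,2)$. A basic sequence is a sequence $Q=\{q_n\}_{n\ge1}$ of integers $q_n\ge2$. The $Q$-Cantor series expansion of $x\in[0,1)$ is the unique expansion $x=\sum_{n\ge1}\frac{E_n}{q_1\cdots q_n}$ with $E_n\in\{0,\ldots,q_n-1\}$ and $E_n\ne q_n-1$ infinitely often. $N_n^Q(B,x)$ is the number of occurrences of the block $B$ (as consecutive digits) in the $Q$-Cantor series expansion of $x$ with starting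 position at most $n$. $Q_n^{(k)}=\sum_{j=1}^n\frac{1}{q_jq_{j+1}\cdots q_{j+k-1}}$. $x$ is $Q$-normal of order $k$ if $\lim_{n\to\infty}N_n^Q(B,x)/Q_n^{(k)}=1$ for all blocks $B$ of length $k$ (in any base), and $Q$-normal if it is $Q$-normal of order $k$ for all positive integers $k$. -}

module Defs where

open import Algebra.Properties.Group using (⁻¹-anti-homo-//)
open import Data.Nat as ℕ using (ℕ; zero; suc; NonZero; _∸_; _^_)
import Data.Nat.Properties as ℕ
open import Data.Nat.Tactic.RingSolver using (solve-∀)
import Data.Integer as ℤ
import Data.Integer.Properties as ℤ
open import Data.Rational as ℚ
  using (ℚ; mkℚ; 0ℚ; 1ℚ; _/_; _÷_; ∣_∣; Positive; NonNegative)
import Data.Rational.Properties as ℚ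
import Data.Rational.Unnormalised as ℚᵘ
import Data.Rational.Unnormalised.Properties as ℚᵘ
open import Data.Fin as Fin using (Fin; toℕ; fromℕ<)
import Data.Fin.Properties as Fin
open import Data.List as List using (List; []; _∷_)
import Data.List.Properties as List
open import Data.Vec as Vec using (Vec; []; _∷_)
open import Data.Product using (∃; _×_; _,_; proj₁; proj₂)
open import Data.Sum using (inj₁; inj₂)
open import Relation.Nullary using (¬_; Dec; yes; no)
open import Relation.Binary.PropositionalEquality

-- All infinite sequences are indexed from 0: the entry with index n is the
-- (n+1)-st term, so "the first n terms" are those with index < n.

∑ : (ℕ → ℚ) → ℕ → ℚ
∑ f zero    = 0ℚ
∑ f (suc n) = ∑ f n ℚ.+ f n

∏ : (ℕ → ℕ) → ℕ → ℕ
∏ f zero    = 1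
∏ f (suc n) = ∏ f n ℕ.* f n

infix 4 _⟶_

_⟶_ : (ℕ → ℚ) → ℚ → Set
a ⟶ c = ∀ ε → 0ℚ ℚ.< ε →
        ∃ λ N → ∀ n → N ℕ.≤ n → ∣ a n ℚ.- c ∣ ℚ.< ε

-- Real numbers, represented by Cauchy sequences of rationals.  They are never
-- compared by _≡_, only through _<ᴿ_.

record ℝ : Set where
  field
    approx : ℕ → ℚ
    cauchy : ∀ ε → 0ℚ ℚ.< ε →
             ∃ λ N → ∀ m n → N ℕ.≤ m → N ℕ.≤ n →
             ∣ approx m ℚ.- approx n ∣ ℚ.< ε

open ℝ public

infix 4 _<ᴿ_ _≤ᴿ_

_<ᴿ_ : ℝ → ℝ → Set
x <ᴿ y = ∃ λ δ → 0ℚ ℚ.< δ ×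
         ∃ λ N → ∀ n → N ℕ.≤ n → approx x n ℚ.+ δ ℚ.≤ approx y n

_≤ᴿ_ : ℝ → ℝ → Set
x ≤ᴿ y = ¬ (y <ᴿ x)

fromℚ : ℚ → ℝ
fromℚ p .approx _ = p
fromℚ p .cauchy ε 0<ε = 0 , λ _ _ _ _ →
  subst (λ d → ∣ d ∣ ℚ.< ε) (sym (ℚ.+-inverseʳ p)) 0<ε

-- The rational sequence s converges to the real x: eventually s n − ε < x < s n + ε.
ConvergesTo : (ℕ → ℚ) → ℝ → Set
ConvergesTo s x = ∀ ε → 0ℚ ℚ.< ε → ∃ λ N → ∀ n → N ℕ.≤ n →
  fromℚ (s n ℚ.- ε) <ᴿ x × x <ᴿ fromℚ (s n ℚ.+ ε)

record BasicSequence : Set where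
  field
    q   : ℕ → ℕ
    2≤q : ∀ n → 2 ℕ.≤ q n

open BasicSequence public

∏-nonZero : ∀ f → (∀ n → NonZero (f n)) → ∀ n → NonZero (∏ f n)
∏-nonZero f f≢0 zero    = _
∏-nonZero f f≢0 (suc n) =
  ℕ.m*n≢0 (∏ f n) (f n) {{∏-nonZero f f≢0 n}} {{f≢0 n}}

-- window Q j k is the product of the k consecutive terms of Q from index j on.
window : BasicSequence → ℕ → ℕ → ℕ
window Q j k = ∏ (λ t → q Q (j ℕ.+ t)) k

window-nonZero : ∀ Q j k → NonZero (window Q j k)
window-nonZero Q j k = ∏-nonZero (λ t → q Q (j ℕ.+ t))
  (λ t → ℕ.>-nonZero (ℕ.<-trans ℕ.z<s (2≤q Q (j ℕ.+ t)))) k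

over : ℕ → (Q : BasicSequence) (j k : ℕ) → ℚ
over a Q j k = (ℤ.+ a / window Q j k) {{window-nonZero Q j k}}

partialSum : BasicSequence → (ℕ → ℕ) → ℕ → ℚ
partialSum Q E = ∑ λ n → over (E n) Q 0 (suc n)

record IsCantorExpansion (Q : BasicSequence) (x : ℝ) (E : ℕ → ℕ) : Set where
  field
    digit<q     : ∀ n → E n ℕ.< q Q n
    nonterminal : ∀ m → ∃ λ n → m ℕ.≤ n × E n ≢ q Q n ∸ 1
    converges   : ConvergesTo (partialSum Q E) x

Block : ℕ → ℕ → Set
Block b k = Vec (Fin b) k

OccursAt : ∀ {b k} → Block b k → (ℕ → ℕ) → ℕ → Set
OccursAt {k = k} B E j = ∀ (t : Fin k) → E (j ℕ.+ toℕ t) ≡ toℕ (Vec.lookup B t)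

occursAt? : ∀ {b k} (B : Block b k) E j → Dec (OccursAt B E j)
occursAt? B E j = Fin.all? λ t → E (j ℕ.+ toℕ t) ℕ.≟ toℕ (Vec.lookup B t)

occurrences : ∀ {b k} → Block b k → (ℕ → ℕ) → ℕ → ℕ
occurrences B E n = List.length (List.filter (occursAt? B E) (List.upTo n))

-- weight Q k n is Q_n^{(k)}.
weight : BasicSequence → ℕ → ℕ → ℚ
weight Q k = ∑ λ j → over 1 Q j k

over-nonNeg : ∀ a Q j k → 0ℚ ℚ.≤ over a Q j k
over-nonNeg a Q j k = ℚ.nonNegative⁻¹ _
  {{ℚ.normalize-nonNeg a (window Q j k) {{window-nonZero Q j k}}}}

∑-nonNeg : ∀ f → (∀ n → 0ℚ ℚ.≤ f n) → ∀ n → 0ℚ ℚ.≤ ∑ f n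
∑-nonNeg f 0≤f zero    = ℚ.≤-refl
∑-nonNeg f 0≤f (suc n) = ℚ.+-mono-≤ (∑-nonNeg f 0≤f n) (0≤f n)

weight-nonZero : ∀ Q k n → ℚ.NonZero (weight Q k (suc n))
weight-nonZero Q k n = ℚ.pos⇒nonZero (weight Q k (suc n)) {{ℚ.positive
  (ℚ.+-mono-≤-<
    (∑-nonNeg (λ j → over 1 Q j k) (λ j → over-nonNeg 1 Q j k) n)
    (ℚ.positive⁻¹ _ {{ℚ.normalize-pos 1 (window Q n k) {{window-nonZero Q n k}}}}))}}

-- Shifted to n + 1, since weight Q k 0 = 0.
normalityRatio : ∀ {b k} → BasicSequence → Block b k → (ℕ → ℕ) → ℕ → ℚ
normalityRatio {k = k} Q B E n =
  ((ℤ.+ occurrences B E (suc n) / 1) ÷ weight Q k (suc n)) {{weight-nonZero Q k n}}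

-- The Q-Cantor series expansion of a real in [0,1) is unique, so "the" expansion
-- is introduced by ∃.
record NormalOfOrder (Q : BasicSequence) (k : ℕ) (x : ℝ) : Set where
  field
    0≤x : fromℚ 0ℚ ≤ᴿ x
    x<1 : x <ᴿ fromℚ 1ℚ
    normal : ∃ λ E → IsCantorExpansion Q x E ×
             (∀ b (B : Block b k) → normalityRatio Q B E ⟶ 1ℚ)

Normal : BasicSequence → ℝ → Set
Normal Q x = ∀ k → 1 ℕ.≤ k → NormalOfOrder Q k x

-- A Cantor series with admissible digits converges: the partial sums s n increase,
-- while s n + 1 / (q₀ ⋯ qₙ₋₁) decreases.
module CantorSeries (Q : BasicSequence) (E : ℕ → ℕ) (E<q : ∀ n → E n ℕ.< q Q n) where

  P : ℕ → ℕ
  P n = window Q 0 n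

  s u : ℕ → ℚ
  s = partialSum Q E
  u n = s n ℚ.+ over 1 Q 0 n

  step : ∀ e p d b .{{_ : NonZero p}} .{{_ : NonZero d}} → d ≡ p ℕ.* b → e ℕ.< b →
         ℤ.+ e / d ℚ.+ ℤ.+ 1 / d ℚ.≤ ℤ.+ 1 / p
  step e (suc p) (suc d) b d≡pb e<b = ℚ.toℚᵘ-cancel-≤ (begin
    ℚ.toℚᵘ (ℤ.+ e / suc d ℚ.+ ℤ.+ 1 / suc d)
      ≃⟨ ℚ.toℚᵘ-homo-+ (ℤ.+ e / suc d) (ℤ.+ 1 / suc d) ⟩
    ℚ.toℚᵘ (ℤ.+ e / suc d) ℚᵘ.+ ℚ.toℚᵘ (ℤ.+ 1 / suc d)
      ≃⟨ ℚᵘ.+-cong (ℚ.toℚᵘ-fromℚᵘ (ℚᵘ.mkℚᵘ (ℤ.+ e) d))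
                   (ℚ.toℚᵘ-fromℚᵘ (ℚᵘ.mkℚᵘ (ℤ.+ 1) d)) ⟩
    ℚᵘ.mkℚᵘ (ℤ.+ e) d ℚᵘ.+ ℚᵘ.mkℚᵘ (ℤ.+ 1) d
      ≤⟨ ℚᵘ.*≤* (subst₂ ℤ._≤_ (sym lhs) (sym rhs) (ℤ.+≤+ crossMultiplied)) ⟩
    ℚᵘ.mkℚᵘ (ℤ.+ 1) p
      ≃⟨ ℚ.toℚᵘ-fromℚᵘ (ℚᵘ.mkℚᵘ (ℤ.+ 1) p) ⟨
    ℚ.toℚᵘ (ℤ.+ 1 / suc p) ∎)
    where
    open ℚᵘ.≤-Reasoning
    D = suc d
    lhs : (ℤ.+ e ℤ.* ℤ.+ D ℤ.+ ℤ.+ 1 ℤ.* ℤ.+ D) ℤ.* ℤ.+ suc p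
          ≡ ℤ.+ ((e ℕ.* D ℕ.+ 1 ℕ.* D) ℕ.* suc p)
    lhs = trans (cong (ℤ._* ℤ.+ suc p)
                  (cong₂ ℤ._+_ (sym (ℤ.pos-* e D)) (sym (ℤ.pos-* 1 D))))
                (sym (ℤ.pos-* (e ℕ.* D ℕ.+ 1 ℕ.* D) (suc p)))
    rhs : ℤ.+ 1 ℤ.* ℤ.+ (D ℕ.* D) ≡ ℤ.+ (D ℕ.* D)
    rhs = ℤ.*-identityˡ (ℤ.+ (D ℕ.* D))
    regroup : ∀ e D p → (e ℕ.* D ℕ.+ 1 ℕ.* D) ℕ.* p ≡ D ℕ.* (p ℕ.* (1 ℕ.+ e))
    regroup = solve-∀
    crossMultiplied : (e ℕ.* D ℕ.+ 1 ℕ.* D) ℕ.* suc p ℕ.≤ D ℕ.* D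
    crossMultiplied = subst₂ ℕ._≤_ (sym (regroup e D (suc p))) (cong (D ℕ.*_) (sym d≡pb))
      (ℕ.*-monoʳ-≤ D (ℕ.*-monoʳ-≤ (suc p) e<b))

  s-step : ∀ n → s n ℚ.≤ s (suc n)
  s-step n = subst (ℚ._≤ s (suc n)) (ℚ.+-identityʳ (s n))
    (ℚ.+-monoʳ-≤ (s n) (over-nonNeg (E n) Q 0 (suc n)))

  u-step : ∀ n → u (suc n) ℚ.≤ u n
  u-step n = subst (ℚ._≤ u n) (sym (ℚ.+-assoc (s n) _ _))
    (ℚ.+-monoʳ-≤ (s n)
      (step (E n) (P n) (P (suc n)) (q Q n)
        {{window-nonZero Q 0 n}} {{window-nonZero Q 0 (suc n)}} refl (E<q n)))

  s≤u : ∀ n → s n ℚ.≤ u n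
  s≤u n = subst (ℚ._≤ u n) (ℚ.+-identityʳ (s n))
    (ℚ.+-monoʳ-≤ (s n) (over-nonNeg 1 Q 0 n))

  bounds : ∀ N k → s N ℚ.≤ s (k ℕ.+ N) × u (k ℕ.+ N) ℚ.≤ u N
  bounds N zero    = ℚ.≤-refl , ℚ.≤-refl
  bounds N (suc k) =
    ℚ.≤-trans (proj₁ (bounds N k)) (s-step (k ℕ.+ N)) ,
    ℚ.≤-trans (u-step (k ℕ.+ N)) (proj₂ (bounds N k))

  sandwich : ∀ N n → N ℕ.≤ n → s N ℚ.≤ s n × s n ℚ.≤ u N
  sandwich N n N≤n with bounds N (n ∸ N)
  ... | lo , hi rewrite ℕ.m∸n+n≡m N≤n = lo , ℚ.≤-trans (s≤u n) hi

  difference : ∀ N {a b} → s N ℚ.≤ a → b ℚ.≤ u N → b ℚ.- a ℚ.≤ over 1 Q 0 N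
  difference N {a} {b} lo hi =
    subst (b ℚ.- a ℚ.≤_) cancel (ℚ.+-mono-≤ hi (ℚ.neg-antimono-≤ lo))
    where
    w = over 1 Q 0 N
    cancel : u N ℚ.- s N ≡ w
    cancel = trans (cong (ℚ._- s N) (ℚ.+-comm (s N) w))
      (trans (ℚ.+-assoc w (s N) (ℚ.- s N))
        (trans (cong (w ℚ.+_) (ℚ.+-inverseʳ (s N))) (ℚ.+-identityʳ w)))

  n<P : ∀ n → n ℕ.< P n
  n<P zero    = ℕ.z<s
  n<P (suc n) = ℕ.≤-trans
    (subst (ℕ._≤ suc n ℕ.* 2) (ℕ.+-comm (suc n) 1)
      (subst (suc n ℕ.+ 1 ℕ.≤_) (double n) (ℕ.+-monoʳ-≤ (suc n) (ℕ.s≤s ℕ.z≤n))))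
    (ℕ.*-mono-≤ (n<P n) (2≤q Q n))
    where
    double : ∀ n → (1 ℕ.+ n) ℕ.+ (1 ℕ.+ n) ≡ (1 ℕ.+ n) ℕ.* 2
    double = solve-∀

  1/p<ε : ∀ p ε .{{_ : NonZero p}} .{{_ : Positive ε}} → ℚ.denominatorℕ ε ℕ.< p →
          ℤ.+ 1 / p ℚ.< ε
  1/p<ε (suc p) ε@(mkℚ ℤ.+[1+ a ] d _) d<p = ℚ.toℚᵘ-cancel-< (ℚᵘ.<-respˡ-≃
    (ℚᵘ.≃-sym (ℚ.toℚᵘ-fromℚᵘ (ℚᵘ.mkℚᵘ (ℤ.+ 1) p)))
    (ℚᵘ.*<* (subst₂ ℤ._<_ (sym (ℤ.*-identityˡ (ℤ.+ suc d))) (ℤ.pos-* (suc a) (suc p))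
      (ℤ.+<+ (ℕ.≤-trans d<p (ℕ.m≤m+n (suc p) (a ℕ.* suc p)))))))

  cantorSum : ℝ
  cantorSum .approx = s
  cantorSum .cauchy ε 0<ε = N , close
    where
    N = ℚ.denominatorℕ ε
    small : over 1 Q 0 N ℚ.< ε
    small = 1/p<ε (P N) ε {{window-nonZero Q 0 N}} {{ℚ.positive 0<ε}} (n<P N)
    close : ∀ m n → N ℕ.≤ m → N ℕ.≤ n → ∣ s m ℚ.- s n ∣ ℚ.< ε
    close m n N≤m N≤n with ℚ.∣p∣≡p∨∣p∣≡-p (s m ℚ.- s n)
    ... | inj₁ eq rewrite eq = ℚ.≤-<-trans
      (difference N (proj₁ (sandwich N n N≤n)) (proj₂ (sandwich N m N≤m))) small
    ... | inj₂ eq rewrite eq = ℚ.≤-<-trans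
      (subst (ℚ._≤ over 1 Q 0 N) flip
        (difference N (proj₁ (sandwich N m N≤m)) (proj₂ (sandwich N n N≤n)))) small
      where
      flip : s n ℚ.- s m ≡ ℚ.- (s m ℚ.- s n)
      flip = sym (⁻¹-anti-homo-// ℚ.+-0-group (s m) (s n))

open CantorSeries public using (cantorSum)

words : ∀ b w → List (Block b w)
words b zero    = [] ∷ []
words b (suc w) = List.concatMap (λ d → List.map (d ∷_) (words b w)) (List.allFin b)

C : ∀ b w → List (Fin b)
C b w = List.concatMap Vec.toList (words b w)

_ : List.map toℕ (C 3 2) ≡
    0 ∷ 0 ∷ 0 ∷ 1 ∷ 0 ∷ 2 ∷ 1 ∷ 0 ∷ 1 ∷ 1 ∷ 1 ∷ 2 ∷ 2 ∷ 0 ∷ 2 ∷ 1 ∷ 2 ∷ 2 ∷ []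
_ = refl

copies : {A : Set} → ℕ → List A → List A
copies m B = List.concat (List.replicate m B)

-- The families b_i, l_i, x_i (base, mult, block) are indexed by i ≥ 1; their values at
-- 0 are never used.

base : ℕ → ℕ
base 1 = 2
base i = i

mult : ℕ → ℕ
mult 1 = 0
mult i = i ^ (3 ℕ.* i)

block : ∀ i → List (Fin (base i))
block 0               = []
block 1               = Fin.zero ∷ Fin.suc Fin.zero ∷ []
block i@(suc (suc _)) = C i (i ^ 2)

L : ℕ → ℕ
L zero    = 0
L (suc i) = L i ℕ.+ mult (suc i) ℕ.* List.length (block (suc i))

-- The i for which the term with index n comes from the copies of block (i + 1).
record Location (n : ℕ) : Set where
  field
    i     : ℕ
    lower : L i ℕ.≤ n
    upper : n ℕ.< L (suc i)

open Location

length-copies : ∀ {A : Set} m (B : List A) → List.length (copies m B) ≡ m ℕ.* List.length B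
length-copies zero    B = refl
length-copies (suc m) B =
  trans (List.length-++ B) (cong (List.length B ℕ.+_) (length-copies m B))

words-nonempty : ∀ b w → 0 ℕ.< List.length (words (suc b) w)
words-nonempty b zero    = ℕ.z<s
words-nonempty b (suc w) = ℕ.<-≤-trans (words-nonempty b w)
  (subst (ℕ._≤ List.length (words (suc b) (suc w)))
    (List.length-map (Fin.zero ∷_) (words (suc b) w))
    (List.length-++-≤ˡ (List.map (Fin.zero ∷_) (words (suc b) w))))

C-nonempty : ∀ b w → 0 ℕ.< w → 0 ℕ.< List.length (C (suc b) w)
C-nonempty b (suc w) _ with words (suc b) (suc w) | words-nonempty b (suc w)
... | (_ ∷ _) ∷ _ | _ = ℕ.z<s

L-increasing : ∀ i → L (suc i) ℕ.< L (suc (suc i))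
L-increasing i = ℕ.m<m+n (L (suc i))
  (ℕ.*-mono-≤ (ℕ.m^n>0 j (3 ℕ.* j)) (C-nonempty (suc i) (j ^ 2) (ℕ.m^n>0 j 2)))
  where j = suc (suc i)

locate : ∀ n → Location n
locate zero = record { i = 1 ; lower = ℕ.z≤n ; upper = L-increasing 0 }
locate (suc n) with locate n
... | loc with suc n ℕ.<? L (suc (i loc))
...   | yes n<L = record { i = i loc ; lower = ℕ.m≤n⇒m≤1+n (lower loc) ; upper = n<L }
...   | no  n≮L = record
  { i     = suc (i loc)
  ; lower = ℕ.≮⇒≥ n≮L
  ; upper = ℕ.≤-<-trans (upper loc) (L-increasing (i loc))
  }

2≤base : ∀ i → 2 ℕ.≤ base (suc i)
2≤base zero    = ℕ.≤-refl
2≤base (suc i) = ℕ.s≤s (ℕ.s≤s ℕ.z≤n)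

exampleQ : BasicSequence
exampleQ .q n   = base (suc (i (locate n)))
exampleQ .2≤q n = 2≤base (i (locate n))

-- The digit with index n is the entry with index n − L i of the copies of block (i + 1).
digit : ∀ n → Fin (q exampleQ n)
digit n = List.lookup (copies (mult j) (block j)) (fromℕ< inside)
  where
  loc = locate n
  j   = suc (i loc)
  inside : n ∸ L (i loc) ℕ.< List.length (copies (mult j) (block j))
  inside = subst (n ∸ L (i loc) ℕ.<_) (sym (length-copies (mult j) (block j)))
    (subst (n ∸ L (i loc) ℕ.<_) (ℕ.m+n∸m≡n (L (i loc)) _)
      (ℕ.∸-monoˡ-< (upper loc) (lower loc)))

exampleE : ℕ → ℕ
exampleE n = toℕ (digit n)

exampleX : ℝ
exampleX = cantorSum exampleQ exampleE λ n → Fin.toℕ<n (digit n)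

{-# OPTIONS --safe #-}

-- Read cyclically, C b w contains every block of length k ≤ w exactly w b^(w−k) times:
-- a window at offset s of a word v consists of the last digits of v followed by the
-- first digits of v + 1, and for each of the w offsets exactly b^(w−k) of the words v
-- produce a given block.  Hence the discrepancy between the number of occurrences of
-- the block and the weight vanishes over each copy of x_i that is followed by another
-- copy, and a segment l_i x_i contributes at most |x_i| to it.  Up to the segment of
-- x_{a+1} the discrepancy is therefore at most a constant plus (a+1) |x_{a+1}|, whereas
-- the weight is at least l_a |x_a| / (a+1)^k.  The former is negligible: since
-- (1 + 1/a)^a ≤ 4, the length |x_{a+1}| = (a+1)^((a+1)²+2) is, up to a polynomial in a,
-- at most 4^a a^(a²+2a), while l_a |x_a| = a^(a²+3a+2).

module Submission where

open import Defs
import Algebra.Properties.Group as Group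
open import Data.Bool using (if_then_else_)
open import Data.Fin as Fin using (Fin; toℕ; fromℕ<)
import Data.Fin.Properties as Fin
import Data.Integer as ℤ
import Data.Integer.Properties as ℤ
open import Data.List as List using (List; []; _∷_; _++_; concat; concatMap; applyUpTo; length; take; drop)
import Data.List.Properties as List
open import Data.List.Relation.Unary.All using (All; []; _∷_)
import Data.List.Relation.Unary.All.Properties as All
open import Data.Nat as ℕ using (ℕ; zero; suc; NonZero; _∸_; _^_; _/_; _%_; s≤s; z≤n)
open import Data.Nat.Divisibility using (divides-refl)
open import Data.Nat.DivMod
import Data.Nat.Properties as ℕ
open import Data.Nat.Tactic.RingSolver using (solve-∀)
open import Data.Product using (∃; _×_; _,_; proj₁; proj₂)
open import Data.Rational as ℚ using (ℚ; 0ℚ; 1ℚ; ½; ∣_∣)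
import Data.Rational.Properties as ℚ
import Data.Rational.Unnormalised as ℚᵘ
import Data.Rational.Unnormalised.Properties as ℚᵘ
open import Data.Sum using (_⊎_; inj₁; inj₂; fromInj₁)
open import Data.Vec as Vec using (Vec; []; _∷_)
open import Function using (_∘_; id; const)
open import Relation.Binary.PropositionalEquality
open import Relation.Nullary using (Dec; yes; no; does; contradiction)
open import Relation.Nullary.Decidable using (dec-true; dec-false; dec⇒maybe)
import Tactic.RingSolver as Ring
open import Tactic.RingSolver.Core.AlmostCommutativeRing using (AlmostCommutativeRing; fromCommutativeRing)

-- Growth of the block lengths against the repetition counts.

module Growth where
  open import Data.Nat using (_+_; _*_; _≤_; _<_; _⊔_; ⌊_/2⌋; ⌈_/2⌉)

  1≤^ : ∀ m n → 1 ≤ suc m ^ n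
  1≤^ m n = ℕ.m^n>0 (suc m) n

  ^-distribʳ-* : ∀ n x y → (x * y) ^ n ≡ x ^ n * y ^ n
  ^-distribʳ-* zero    x y = refl
  ^-distribʳ-* (suc n) x y = trans (cong (x * y *_) (^-distribʳ-* n x y)) (regroup x y (x ^ n) (y ^ n))
    where
    regroup : ∀ x y p q → x * y * (p * q) ≡ x * p * (y * q)
    regroup = solve-∀

  -- Bernoulli's inequality (1 − 1/(a+1))^h ≥ 1 − h/(a+1), with g = a + 1 − h.
  ^-bernoulli : ∀ a h g → h + g ≡ suc a → suc a ^ h * g ≤ a ^ h * suc a
  ^-bernoulli a zero    g refl = ℕ.≤-refl
  ^-bernoulli a (suc h) g eq   = begin
    suc a * suc a ^ h * g           ≡⟨ regroup (suc a) (suc a ^ h) g ⟩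
    suc a ^ h * (g + a * g)         ≤⟨ ℕ.*-monoʳ-≤ (suc a ^ h) (ℕ.+-monoˡ-≤ (a * g) g≤a) ⟩
    suc a ^ h * (a + a * g)         ≡⟨ regroup′ (suc a ^ h) a g ⟩
    a * (suc a ^ h * suc g)         ≤⟨ ℕ.*-monoʳ-≤ a (^-bernoulli a h (suc g) (trans (ℕ.+-suc h g) eq)) ⟩
    a * (a ^ h * suc a)             ≡⟨ ℕ.*-assoc a (a ^ h) (suc a) ⟨
    a * a ^ h * suc a               ∎
    where
    open ℕ.≤-Reasoning
    g≤a : g ≤ a
    g≤a = subst (g ≤_) (ℕ.suc-injective eq) (ℕ.m≤n+m g h)
    regroup : ∀ s p g → s * p * g ≡ p * (s * g)
    regroup = solve-∀
    regroup′ : ∀ p a g → p * (a + a * g) ≡ a * (p * (1 + g))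
    regroup′ = solve-∀

  -- When g is at least half of a + 1, Bernoulli's inequality gives (1 - 1/(a+1))^h ≥ g/(a+1) ≥ 1/2.
  ^-half : ∀ a h g → h + g ≡ suc a → h ≤ g → suc a ^ h ≤ 2 * a ^ h
  ^-half a h g eq h≤g = ℕ.*-cancelʳ-≤ _ _ (suc a) (begin
    suc a ^ h * suc a      ≡⟨ cong (suc a ^ h *_) eq ⟨
    suc a ^ h * (h + g)    ≤⟨ ℕ.*-monoʳ-≤ (suc a ^ h) (ℕ.+-monoˡ-≤ g h≤g) ⟩
    suc a ^ h * (g + g)    ≡⟨ regroup (suc a ^ h) g ⟩
    2 * (suc a ^ h * g)    ≤⟨ ℕ.*-monoʳ-≤ 2 (^-bernoulli a h g eq) ⟩
    2 * (a ^ h * suc a)    ≡⟨ ℕ.*-assoc 2 (a ^ h) (suc a) ⟨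
    2 * a ^ h * suc a      ∎)
    where
    open ℕ.≤-Reasoning
    regroup : ∀ p g → p * (g + g) ≡ 2 * (p * g)
    regroup = solve-∀

  -- The exponent splits into floor and ceiling of a/2. Each is at most (a+1)/2, as `^-half`
  -- demands, and each costs a factor 2.
  [1+a]^a≤4a^a : ∀ a → suc a ^ a ≤ 4 * a ^ a
  [1+a]^a≤4a^a a = begin
    suc a ^ a                    ≡⟨ cong (suc a ^_) (ℕ.⌊n/2⌋+⌈n/2⌉≡n a) ⟨
    suc a ^ (f + c)              ≡⟨ ℕ.^-distribˡ-+-* (suc a) f c ⟩
    suc a ^ f * suc a ^ c        ≤⟨ ℕ.*-mono-≤
      (^-half a f (suc c) (trans (ℕ.+-suc f c) (cong suc (ℕ.⌊n/2⌋+⌈n/2⌉≡n a)))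
        (ℕ.m≤n⇒m≤1+n (ℕ.⌊n/2⌋≤⌈n/2⌉ a)))
      (^-half a c (suc f) (trans (ℕ.+-comm c (suc f)) (cong suc (ℕ.⌊n/2⌋+⌈n/2⌉≡n a)))
        (ℕ.⌊n/2⌋-mono (ℕ.n≤1+n (suc a)))) ⟩
    2 * a ^ f * (2 * a ^ c)      ≡⟨ regroup (a ^ f) (a ^ c) ⟩
    4 * (a ^ f * a ^ c)          ≡⟨ cong (4 *_) (ℕ.^-distribˡ-+-* a f c) ⟨
    4 * a ^ (f + c)              ≡⟨ cong (λ n → 4 * a ^ n) (ℕ.⌊n/2⌋+⌈n/2⌉≡n a) ⟩
    4 * a ^ a                    ∎
    where
    open ℕ.≤-Reasoning
    f = ⌊ a /2⌋
    c = ⌈ a /2⌉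
    regroup : ∀ x y → 2 * x * (2 * y) ≡ 4 * (x * y)
    regroup = solve-∀

  -- Since (a+1)² = a(a+2) + 1, the power is ((a+1)^a)^(a+2) with one further factor a + 1.
  [1+a]^[1+a]² : ∀ a → suc a ^ (suc a ^ 2) ≤ 4 ^ (a + 2) * a ^ (a * (a + 2)) * suc a
  [1+a]^[1+a]² a = begin
    suc a ^ (suc a ^ 2)                        ≡⟨ cong (suc a ^_) (regroup a) ⟩
    suc a ^ (a * (a + 2) + 1)                  ≡⟨ ℕ.^-distribˡ-+-* (suc a) (a * (a + 2)) 1 ⟩
    suc a ^ (a * (a + 2)) * suc a ^ 1          ≡⟨ cong₂ _*_
      (sym (ℕ.^-*-assoc (suc a) a (a + 2))) (ℕ.^-identityʳ (suc a)) ⟩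
    (suc a ^ a) ^ (a + 2) * suc a              ≤⟨ ℕ.*-monoˡ-≤ (suc a) (ℕ.^-monoˡ-≤ (a + 2) ([1+a]^a≤4a^a a)) ⟩
    (4 * a ^ a) ^ (a + 2) * suc a              ≡⟨ cong (_* suc a) (^-distribʳ-* (a + 2) 4 (a ^ a)) ⟩
    4 ^ (a + 2) * (a ^ a) ^ (a + 2) * suc a    ≡⟨ cong (λ p → 4 ^ (a + 2) * p * suc a)
      (ℕ.^-*-assoc a a (a + 2)) ⟩
    4 ^ (a + 2) * a ^ (a * (a + 2)) * suc a    ∎
    where
    open ℕ.≤-Reasoning
    regroup : ∀ a → (1 + a) * ((1 + a) * 1) ≡ a * (a + 2) + 1
    regroup = solve-∀

  -- Write a + 2 = e + t. The part a^e of the right side pays for (a+1)^e ≤ 2^e a^e, and the part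
  -- a^t ≥ (4X)^t pays for 4^t and for the constant X, which collects m, 2^e and 4^e.
  exponential-dominates : ∀ m e → ∃ λ A → ∀ a → A ≤ a →
                          m * (suc a ^ e * 4 ^ (a + 2)) ≤ a ^ (a + 2)
  exponential-dominates m e = e + 4 * X , bound
    where
    -- Taking `suc m` makes X positive for every m; this yields a ≥ 1, hence a + 1 ≤ 2a, and also X
    -- ≤ X^t.
    X = suc m * (2 ^ e * 4 ^ e)
    1≤X : 1 ≤ X
    1≤X = ℕ.*-mono-≤ (ℕ.s≤s (ℕ.z≤n {m})) (ℕ.*-mono-≤ (1≤^ 1 e) (1≤^ 3 e))
    bound : ∀ a → e + 4 * X ≤ a → m * (suc a ^ e * 4 ^ (a + 2)) ≤ a ^ (a + 2)
    bound a A≤a = begin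
      m * (suc a ^ e * 4 ^ (a + 2))
        ≤⟨ ℕ.*-mono-≤ (ℕ.n≤1+n m) (ℕ.*-monoˡ-≤ (4 ^ (a + 2)) (ℕ.^-monoˡ-≤ e 1+a≤2a)) ⟩
      suc m * ((2 * a) ^ e * 4 ^ (a + 2))
        ≡⟨ cong₂ (λ p q → suc m * (p * q)) (^-distribʳ-* e 2 a)
             (trans (cong (4 ^_) split) (ℕ.^-distribˡ-+-* 4 e t)) ⟩
      suc m * (2 ^ e * a ^ e * (4 ^ e * 4 ^ t))
        ≡⟨ regroup (suc m) (2 ^ e) (a ^ e) (4 ^ e) (4 ^ t) ⟩
      a ^ e * (4 ^ t * X)
        ≤⟨ ℕ.*-monoʳ-≤ (a ^ e) (ℕ.*-monoʳ-≤ (4 ^ t) X≤X^t) ⟩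
      a ^ e * (4 ^ t * X ^ t)
        ≡⟨ cong (a ^ e *_) (^-distribʳ-* t 4 X) ⟨
      a ^ e * (4 * X) ^ t
        ≤⟨ ℕ.*-monoʳ-≤ (a ^ e) (ℕ.^-monoˡ-≤ t (ℕ.≤-trans (ℕ.m≤n+m (4 * X) e) A≤a)) ⟩
      a ^ e * a ^ t
        ≡⟨ ℕ.^-distribˡ-+-* a e t ⟨
      a ^ (e + t)
        ≡⟨ cong (a ^_) split ⟨
      a ^ (a + 2) ∎
      where
      open ℕ.≤-Reasoning
      r t : ℕ
      r = a ∸ e
      t = suc (suc r)
      split : a + 2 ≡ e + t
      split = trans (cong (_+ 2) (sym (ℕ.m+[n∸m]≡n (ℕ.≤-trans (ℕ.m≤m+n e (4 * X)) A≤a)))) (comm e r)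
        where
        comm : ∀ e r → e + r + 2 ≡ e + (2 + r)
        comm = solve-∀
      1+a≤2a : suc a ≤ 2 * a
      1+a≤2a = ℕ.+-mono-≤
        (ℕ.≤-trans (ℕ.≤-trans 1≤X (ℕ.m≤m+n X _)) (ℕ.≤-trans (ℕ.m≤n+m (4 * X) e) A≤a))
        (ℕ.≤-reflexive (sym (ℕ.+-identityʳ a)))
      X≤X^t : X ≤ X ^ t
      X≤X^t = ℕ.≤-trans (ℕ.≤-reflexive (sym (ℕ.^-identityʳ X)))
        (ℕ.^-monoʳ-≤ X {{ℕ.>-nonZero 1≤X}} {1} {t} (ℕ.s≤s ℕ.z≤n))
      regroup : ∀ m x y z w → m * (x * y * (z * w)) ≡ y * (w * (m * (x * z)))
      regroup = solve-∀

  -- The right side is l_a |x_a|. On the left, |x_{a+1}| occurs inside the bound c + (a+1) |x_{a+1}|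
  -- for the discrepancy; (a+1)^k comes from the lower bound for the weight, and 1/m is the
  -- precision asked for.
  period-negligible : ∀ m k c → ∃ λ A → ∀ a → A ≤ a →
    m * (suc a ^ k * (c + suc a * (suc a ^ (suc a ^ 2) * suc a ^ 2)))
      ≤ a ^ (3 * a) * (a ^ (a ^ 2) * a ^ 2)
  period-negligible m k c = A ⊔ c , bound
    where
    A : ℕ
    A = proj₁ (exponential-dominates (2 * m) (k + 4))
    bound : ∀ a → A ⊔ c ≤ a →
      m * (suc a ^ k * (c + suc a * (suc a ^ (suc a ^ 2) * suc a ^ 2)))
        ≤ a ^ (3 * a) * (a ^ (a ^ 2) * a ^ 2)
    bound a A≤a = begin
      m * (s ^ k * (c + s * (s ^ (s ^ 2) * s ^ 2)))
        -- For a ≥ c the constant is dominated by the other summand, so the bracket at most doubles.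
        ≤⟨ ℕ.*-monoʳ-≤ m (ℕ.*-monoʳ-≤ (s ^ k) (ℕ.+-monoˡ-≤ _ c≤)) ⟩
      m * (s ^ k * (s * (s ^ (s ^ 2) * s ^ 2) + s * (s ^ (s ^ 2) * s ^ 2)))
        ≡⟨ regroup m (s ^ k) s (s ^ (s ^ 2)) ⟩
      2 * m * (s ^ k * (s * (s * (s * 1)))) * s ^ (s ^ 2)
        ≤⟨ ℕ.*-monoʳ-≤ (2 * m * (s ^ k * (s * (s * (s * 1))))) ([1+a]^[1+a]² a) ⟩
      2 * m * (s ^ k * (s * (s * (s * 1)))) * (4 ^ (a + 2) * a ^ (a * (a + 2)) * s)
        ≡⟨ regroup′ m (s ^ k) s (4 ^ (a + 2)) (a ^ (a * (a + 2))) ⟩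
      a ^ (a * (a + 2)) * (2 * m * (s ^ k * s ^ 4 * 4 ^ (a + 2)))
        -- Three factors a + 1 come from the bracket and the fourth from `[1+a]^[1+a]²`, hence the
        -- exponent k + 4.
        ≡⟨ cong (λ p → a ^ (a * (a + 2)) * (2 * m * (p * 4 ^ (a + 2)))) (ℕ.^-distribˡ-+-* s k 4) ⟨
      a ^ (a * (a + 2)) * (2 * m * (s ^ (k + 4) * 4 ^ (a + 2)))
        ≤⟨ ℕ.*-monoʳ-≤ (a ^ (a * (a + 2)))
             (proj₂ (exponential-dominates (2 * m) (k + 4)) a (ℕ.m⊔n≤o⇒m≤o A c A≤a)) ⟩
      a ^ (a * (a + 2)) * a ^ (a + 2)
        ≡⟨ ℕ.^-distribˡ-+-* a (a * (a + 2)) (a + 2) ⟨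
      a ^ (a * (a + 2) + (a + 2))
        ≡⟨ cong (a ^_) (exponent a) ⟩
      a ^ (3 * a + (a ^ 2 + 2))
        ≡⟨ ℕ.^-distribˡ-+-* a (3 * a) (a ^ 2 + 2) ⟩
      a ^ (3 * a) * a ^ (a ^ 2 + 2)
        ≡⟨ cong (a ^ (3 * a) *_) (ℕ.^-distribˡ-+-* a (a ^ 2) 2) ⟩
      a ^ (3 * a) * (a ^ (a ^ 2) * a ^ 2) ∎
      where
      open ℕ.≤-Reasoning
      s = suc a
      c≤ : c ≤ s * (s ^ (s ^ 2) * s ^ 2)
      c≤ = ℕ.≤-trans (ℕ.≤-trans (ℕ.m⊔n≤o⇒n≤o A c A≤a) (ℕ.n≤1+n a))
        (ℕ.≤-trans (ℕ.≤-reflexive (sym (ℕ.*-identityʳ s)))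
          (ℕ.*-monoʳ-≤ s (ℕ.*-mono-≤ (1≤^ a (s ^ 2)) (1≤^ a 2))))
      regroup : ∀ m p s q → m * (p * (s * (q * (s * (s * 1))) + s * (q * (s * (s * 1)))))
                            ≡ 2 * m * (p * (s * (s * (s * 1)))) * q
      regroup = solve-∀
      regroup′ : ∀ m p s x y → 2 * m * (p * (s * (s * (s * 1)))) * (x * y * s)
                               ≡ y * (2 * m * (p * (s * (s * (s * (s * 1)))) * x))
      regroup′ = solve-∀
      exponent : ∀ a → a * (a + 2) + (a + 2) ≡ 3 * a + (a * (a * 1) + 2)
      exponent = solve-∀

open Growth using (period-negligible)
open import Data.Rational using (_+_; _*_; _-_; -_; _≤_; _<_; _÷_; 1/_)

-- Sums of rational numbers

ℚ-ring : AlmostCommutativeRing _ _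
ℚ-ring = fromCommutativeRing ℚ.+-*-commutativeRing λ p → dec⇒maybe (0ℚ ℚ.≟ p)

ι : ℕ → ℚ
ι n = ℤ.+ n ℚ./ 1

recip : ∀ n → .{{NonZero n}} → ℚ
recip n = ℤ.+ 1 ℚ./ n

ι-+ : ∀ m n → ι (m ℕ.+ n) ≡ ι m + ι n
ι-+ m n = ℚ.toℚᵘ-injective (begin-equality
  ℚ.toℚᵘ (ι (m ℕ.+ n))
    ≃⟨ ℚ.toℚᵘ-fromℚᵘ (ℚᵘ.mkℚᵘ (ℤ.+ (m ℕ.+ n)) 0) ⟩
  ℚᵘ.mkℚᵘ (ℤ.+ (m ℕ.+ n)) 0
    ≃⟨ ℚᵘ.*≡* (cong (ℤ._* ℤ.+ 1)
         (sym (cong₂ ℤ._+_ (ℤ.*-identityʳ (ℤ.+ m)) (ℤ.*-identityʳ (ℤ.+ n))))) ⟩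
  ℚᵘ.mkℚᵘ (ℤ.+ m) 0 ℚᵘ.+ ℚᵘ.mkℚᵘ (ℤ.+ n) 0
    ≃⟨ ℚᵘ.+-cong (ℚ.toℚᵘ-fromℚᵘ (ℚᵘ.mkℚᵘ (ℤ.+ m) 0)) (ℚ.toℚᵘ-fromℚᵘ (ℚᵘ.mkℚᵘ (ℤ.+ n) 0)) ⟨
  ℚ.toℚᵘ (ι m) ℚᵘ.+ ℚ.toℚᵘ (ι n)
    ≃⟨ ℚ.toℚᵘ-homo-+ (ι m) (ι n) ⟨
  ℚ.toℚᵘ (ι m + ι n) ∎)
  where open ℚᵘ.≤-Reasoning

ι-* : ∀ m n → ι (m ℕ.* n) ≡ ι m * ι n
ι-* zero    n = sym (ℚ.*-zeroˡ (ι n))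
ι-* (suc m) n = begin
  ι (n ℕ.+ m ℕ.* n)   ≡⟨ ι-+ n (m ℕ.* n) ⟩
  ι n + ι (m ℕ.* n)   ≡⟨ cong (ι n +_) (ι-* m n) ⟩
  ι n + ι m * ι n     ≡⟨ cong (_+ ι m * ι n) (ℚ.*-identityˡ (ι n)) ⟨
  1ℚ * ι n + ι m * ι n ≡⟨ ℚ.*-distribʳ-+ (ι n) 1ℚ (ι m) ⟨
  (1ℚ + ι m) * ι n    ≡⟨ cong (_* ι n) (ι-+ 1 m) ⟨
  ι (suc m) * ι n     ∎
  where open ≡-Reasoning

0≤ι : ∀ n → 0ℚ ≤ ι n
0≤ι n = ℚ.nonNegative⁻¹ _ {{ℚ.normalize-nonNeg n 1}}

p≤p+q : ∀ p {q} → 0ℚ ≤ q → p ≤ p + q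
p≤p+q p 0≤q = subst (_≤ p + _) (ℚ.+-identityʳ p) (ℚ.+-monoʳ-≤ p 0≤q)

ι-mono : ∀ {m n} → m ℕ.≤ n → ι m ≤ ι n
ι-mono {m} {n} m≤n = subst (ι m ≤_)
  (trans (sym (ι-+ m (n ∸ m))) (cong ι (ℕ.m+[n∸m]≡n m≤n))) (p≤p+q (ι m) (0≤ι (n ∸ m)))

recip-inverse : ∀ n .{{_ : NonZero n}} → recip n * ι n ≡ 1ℚ
recip-inverse (suc n) = ℚ.toℚᵘ-injective (begin-equality
  ℚ.toℚᵘ (recip (suc n) * ι (suc n))                  ≃⟨ ℚ.toℚᵘ-homo-* (recip (suc n)) (ι (suc n)) ⟩
  ℚ.toℚᵘ (recip (suc n)) ℚᵘ.* ℚ.toℚᵘ (ι (suc n))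
    ≃⟨ ℚᵘ.*-cong (ℚ.toℚᵘ-fromℚᵘ (ℚᵘ.mkℚᵘ (ℤ.+ 1) n)) (ℚ.toℚᵘ-fromℚᵘ (ℚᵘ.mkℚᵘ (ℤ.+ suc n) 0)) ⟩
  ℚᵘ.mkℚᵘ (ℤ.+ 1) n ℚᵘ.* ℚᵘ.mkℚᵘ (ℤ.+ suc n) 0        ≃⟨ ℚᵘ.*≡* (cong ℤ.+_ eq) ⟩
  ℚ.toℚᵘ 1ℚ                                           ∎)
  where
  open ℚᵘ.≤-Reasoning
  eq : suc (n ℕ.+ 0) ℕ.* 1 ≡ suc (n ℕ.* 1 ℕ.+ 0)
  eq = cong suc (trans (ℕ.*-identityʳ (n ℕ.+ 0)) (cong (ℕ._+ 0) (sym (ℕ.*-identityʳ n))))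

0≤recip : ∀ n .{{_ : NonZero n}} → 0ℚ ≤ recip n
0≤recip n = ℚ.nonNegative⁻¹ _ {{ℚ.normalize-nonNeg 1 n}}

recip≤1 : ∀ n .{{_ : NonZero n}} → recip n ≤ 1ℚ
recip≤1 n@(suc _) = begin
  recip n          ≡⟨ ℚ.*-identityʳ (recip n) ⟨
  recip n * 1ℚ     ≤⟨ ℚ.*-monoˡ-≤-nonNeg (recip n) {{ℚ.normalize-nonNeg 1 n}}
                        (ι-mono (ℕ.s≤s (ℕ.z≤n {ℕ.pred n}))) ⟩
  recip n * ι n    ≡⟨ recip-inverse n ⟩
  1ℚ               ∎
  where open ℚ.≤-Reasoning

∑-cong : ∀ {f g} n → (∀ i → i ℕ.< n → f i ≡ g i) → ∑ f n ≡ ∑ g n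
∑-cong zero    eq = refl
∑-cong (suc n) eq = cong₂ _+_ (∑-cong n λ i i<n → eq i (ℕ.m<n⇒m<1+n i<n)) (eq n (ℕ.n<1+n n))

∑-distribʳ : ∀ f c n → ∑ (λ i → f i * c) n ≡ ∑ f n * c
∑-distribʳ f c zero    = sym (ℚ.*-zeroˡ c)
∑-distribʳ f c (suc n) = trans (cong (_+ f n * c) (∑-distribʳ f c n)) (sym (ℚ.*-distribʳ-+ c (∑ f n) (f n)))

∑-+ : ∀ f g n → ∑ (λ i → f i + g i) n ≡ ∑ f n + ∑ g n
∑-+ f g zero    = refl
∑-+ f g (suc n) = trans (cong (_+ (f n + g n)) (∑-+ f g n)) (interchange (∑ f n) (∑ g n) (f n) (g n))
  where
  interchange : ∀ a b c d → a + b + (c + d) ≡ a + c + (b + d)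
  interchange = Ring.solve-∀ ℚ-ring

∑-neg : ∀ f n → ∑ (λ i → - f i) n ≡ - ∑ f n
∑-neg f zero    = refl
∑-neg f (suc n) = trans (cong (_- f n) (∑-neg f n)) (sym (ℚ.neg-distrib-+ (∑ f n) (f n)))

∑-const : ∀ c n → ∑ (λ _ → c) n ≡ ι n * c
∑-const c zero    = sym (ℚ.*-zeroˡ c)
∑-const c (suc n) = begin
  ∑ (λ _ → c) n + c   ≡⟨ cong₂ _+_ (∑-const c n) (sym (ℚ.*-identityˡ c)) ⟩
  ι n * c + 1ℚ * c    ≡⟨ ℚ.*-distribʳ-+ c (ι n) 1ℚ ⟨
  (ι n + 1ℚ) * c      ≡⟨ cong (_* c) (ℚ.+-comm (ι n) 1ℚ) ⟩
  (1ℚ + ι n) * c      ≡⟨ cong (_* c) (ι-+ 1 n) ⟨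
  ι (suc n) * c       ∎
  where open ≡-Reasoning

∑-zero : ∀ {f} n → (∀ i → i ℕ.< n → f i ≡ 0ℚ) → ∑ f n ≡ 0ℚ
∑-zero n eq = trans (∑-cong n eq) (trans (∑-const 0ℚ n) (ℚ.*-zeroʳ (ι n)))

∑-split : ∀ f m n → ∑ f (m ℕ.+ n) ≡ ∑ f m + ∑ (λ i → f (m ℕ.+ i)) n
∑-split f m zero    = trans (cong (∑ f) (ℕ.+-identityʳ m)) (sym (ℚ.+-identityʳ (∑ f m)))
∑-split f m (suc n) = trans (cong (∑ f) (ℕ.+-suc m n))
  (trans (cong (_+ f (m ℕ.+ n)) (∑-split f m n)) (ℚ.+-assoc (∑ f m) _ _))

∑-nested : ∀ f m n → ∑ f (m ℕ.* n) ≡ ∑ (λ i → ∑ (λ j → f (i ℕ.* n ℕ.+ j)) n) m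
∑-nested f zero    n = refl
∑-nested f (suc m) n = trans (cong (∑ f) (ℕ.+-comm n (m ℕ.* n)))
  (trans (∑-split f (m ℕ.* n) n) (cong (_+ ∑ (λ j → f (m ℕ.* n ℕ.+ j)) n) (∑-nested f m n)))

∑-swap : ∀ (f : ℕ → ℕ → ℚ) m n → ∑ (λ i → ∑ (f i) n) m ≡ ∑ (λ j → ∑ (λ i → f i j) m) n
∑-swap f zero    n = sym (∑-zero n λ _ _ → refl)
∑-swap f (suc m) n = trans (cong (_+ ∑ (f m) n) (∑-swap f m n)) (sym (∑-+ (λ j → ∑ (λ i → f i j) m) (f m) n))

∑-rotate : ∀ f n → f n ≡ f 0 → ∑ (f ∘ suc) n ≡ ∑ f n
∑-rotate f n eq = Group.∙-cancelˡ ℚ.+-0-group (f 0) _ _ (begin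
  f 0 + ∑ (f ∘ suc) n          ≡⟨ cong (_+ ∑ (f ∘ suc) n) (ℚ.+-identityˡ (f 0)) ⟨
  ∑ f 1 + ∑ (f ∘ suc) n        ≡⟨ ∑-split f 1 n ⟨
  ∑ f n + f n                  ≡⟨ cong (∑ f n +_) eq ⟩
  ∑ f n + f 0                  ≡⟨ ℚ.+-comm (∑ f n) (f 0) ⟩
  f 0 + ∑ f n                  ∎)
  where open ≡-Reasoning

-- Moving a full period by one step drops its first term and gains an equal one at the end
-- (`∑-rotate`); induction on the shift c does the rest.
∑-shift : ∀ f n → (∀ i → f (n ℕ.+ i) ≡ f i) → ∀ c → ∑ (λ i → f (i ℕ.+ c)) n ≡ ∑ f n
∑-shift f n periodic zero    = ∑-cong n λ i _ → cong f (ℕ.+-identityʳ i)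
∑-shift f n periodic (suc c) = begin
  ∑ (λ i → f (i ℕ.+ suc c)) n     ≡⟨ ∑-cong n (λ i _ → cong f (ℕ.+-suc i c)) ⟩
  ∑ (λ i → f (suc (i ℕ.+ c))) n   ≡⟨ ∑-shift (f ∘ suc) n
    (λ i → trans (cong f (sym (ℕ.+-suc n i))) (periodic (suc i))) c ⟩
  ∑ (f ∘ suc) n                   ≡⟨ ∑-rotate f n (trans (cong f (sym (ℕ.+-identityʳ n))) (periodic 0)) ⟩
  ∑ f n                           ∎
  where open ≡-Reasoning

∑-abs : ∀ f n → (∀ i → ∣ f i ∣ ≤ 1ℚ) → ∣ ∑ f n ∣ ≤ ι n
∑-abs f zero    bound = ℚ.≤-refl
∑-abs f (suc n) bound = begin
  ∣ ∑ f n + f n ∣        ≤⟨ ℚ.∣p+q∣≤∣p∣+∣q∣ (∑ f n) (f n) ⟩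
  ∣ ∑ f n ∣ + ∣ f n ∣    ≤⟨ ℚ.+-mono-≤ (∑-abs f n bound) (bound n) ⟩
  ι n + 1ℚ               ≡⟨ ℚ.+-comm (ι n) 1ℚ ⟩
  1ℚ + ι n               ≡⟨ ι-+ 1 n ⟨
  ι (suc n)              ∎
  where open ℚ.≤-Reasoning

-- Occurrences of a block as sums of rational indicators.

δ : ℕ → ℕ → ℚ
δ m n = if does (m ℕ.≟ n) then 1ℚ else 0ℚ

δ-≡ : ∀ {m n} → m ≡ n → δ m n ≡ 1ℚ
δ-≡ {m} {n} m≡n = cong (if_then 1ℚ else 0ℚ) (dec-true (m ℕ.≟ n) m≡n)

δ-≢ : ∀ {m n} → m ≢ n → δ m n ≡ 0ℚ
δ-≢ {m} {n} m≢n = cong (if_then 1ℚ else 0ℚ) (dec-false (m ℕ.≟ n) m≢n)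

∑-δ : ∀ d c n → d ℕ.< n → ∑ (λ e → δ e d * c) n ≡ c
∑-δ d c (suc n) d<1+n with d ℕ.≟ n
... | yes refl = begin
  ∑ (λ e → δ e n * c) n + δ n n * c
    ≡⟨ cong₂ (λ x y → x + y * c)
         (∑-zero n λ e e<n → trans (cong (_* c) (δ-≢ (ℕ.<⇒≢ e<n))) (ℚ.*-zeroˡ c))
         (δ-≡ {n} refl) ⟩
  0ℚ + 1ℚ * c      ≡⟨ ℚ.+-identityˡ (1ℚ * c) ⟩
  1ℚ * c           ≡⟨ ℚ.*-identityˡ c ⟩
  c                ∎
  where open ≡-Reasoning
... | no d≢n = begin
  ∑ (λ e → δ e d * c) n + δ n d * c
    ≡⟨ cong₂ (λ x y → x + y * c) (∑-δ d c n (ℕ.≤∧≢⇒< (ℕ.s≤s⁻¹ d<1+n) d≢n)) (δ-≢ (d≢n ∘ sym)) ⟩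
  c + 0ℚ * c       ≡⟨ cong (c +_) (ℚ.*-zeroˡ c) ⟩
  c + 0ℚ           ≡⟨ ℚ.+-identityʳ c ⟩
  c                ∎
  where open ≡-Reasoning

-- The indicator that f begins with B, as a product of Kronecker deltas. Rational values turn counts
-- into sums that can be exchanged and factored, and a plain list can be cut at a word boundary.
match : List ℕ → (ℕ → ℕ) → ℚ
match []      f = 1ℚ
match (d ∷ B) f = δ (f 0) d * match B (f ∘ suc)

match-cong : ∀ B {f g} → (∀ t → t ℕ.< List.length B → f t ≡ g t) → match B f ≡ match B g
match-cong []      eq = refl
match-cong (d ∷ B) eq = cong₂ (λ x y → δ x d * y) (eq 0 ℕ.z<s)
  (match-cong B λ t t<n → eq (suc t) (ℕ.s<s t<n))

match-split : ∀ u B f →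
  match B f ≡ match (List.take u B) f * match (List.drop u B) (λ t → f (u ℕ.+ t))
match-split zero    B       f = sym (ℚ.*-identityˡ (match B f))
match-split (suc u) []      f = refl
match-split (suc u) (d ∷ B) f = trans (cong (δ (f 0) d *_) (match-split u B (f ∘ suc)))
  (sym (ℚ.*-assoc (δ (f 0) d) _ _))

digits : ∀ {b k} → Vec (Fin b) k → List ℕ
digits []      = []
digits (d ∷ B) = toℕ d ∷ digits B

length-digits : ∀ {b k} (B : Vec (Fin b) k) → List.length (digits B) ≡ k
length-digits []      = refl
length-digits (d ∷ B) = cong suc (length-digits B)

match-true : ∀ {b k} (B : Vec (Fin b) k) f → (∀ t → f (toℕ t) ≡ toℕ (Vec.lookup B t)) →
             match (digits B) f ≡ 1ℚ
match-true []      f eq = refl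
match-true (d ∷ B) f eq = cong₂ _*_ (δ-≡ (eq Fin.zero)) (match-true B (f ∘ suc) (eq ∘ Fin.suc))

-- Either the indicator vanishes or there is a genuine occurrence. Both the bounds 0 and 1 and the
-- agreement with `occursAt?` are read off from this alternative.
match-01 : ∀ {b k} (B : Vec (Fin b) k) f →
           match (digits B) f ≡ 0ℚ ⊎ (∀ t → f (toℕ t) ≡ toℕ (Vec.lookup B t))
match-01 []      f = inj₂ λ ()
match-01 (d ∷ B) f with f 0 ℕ.≟ toℕ d | match-01 B (f ∘ suc)
... | no ¬e | _       =
  inj₁ (trans (cong (_* match (digits B) (f ∘ suc)) (δ-≢ ¬e)) (ℚ.*-zeroˡ (match (digits B) (f ∘ suc))))
... | yes e | inj₁ eq = inj₁ (trans (cong₂ _*_ (δ-≡ e) eq) (ℚ.*-zeroʳ 1ℚ))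
... | yes e | inj₂ h  = inj₂ λ { Fin.zero → e ; (Fin.suc t) → h t }

0≤match≤1 : ∀ {b k} (B : Vec (Fin b) k) f → 0ℚ ≤ match (digits B) f × match (digits B) f ≤ 1ℚ
0≤match≤1 B f with match-01 B f
... | inj₁ eq rewrite eq = ℚ.≤-refl , 0≤ι 1
... | inj₂ h rewrite match-true B f h = 0≤ι 1 , ℚ.≤-refl

ι-occurrences : ∀ {b k} (B : Vec (Fin b) k) E n →
                ι (occurrences B E n) ≡ ∑ (λ j → match (digits B) (λ t → E (j ℕ.+ t))) n
ι-occurrences B E zero    = refl
ι-occurrences B E (suc n) = begin
  ι (occurrences B E (suc n))
    ≡⟨ cong (ι ∘ List.length ∘ List.filter (occursAt? B E)) (List.upTo-∷ʳ n) ⟨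
  ι (List.length (List.filter (occursAt? B E) (List.upTo n List.∷ʳ n)))
    ≡⟨ cong (ι ∘ List.length) (List.filter-++ (occursAt? B E) (List.upTo n) (n ∷ [])) ⟩
  ι (List.length (List.filter (occursAt? B E) (List.upTo n) List.++ List.filter (occursAt? B E) (n ∷ [])))
    ≡⟨ cong ι (List.length-++ (List.filter (occursAt? B E) (List.upTo n))) ⟩
  ι (occurrences B E n ℕ.+ List.length (List.filter (occursAt? B E) (n ∷ [])))
    ≡⟨ ι-+ (occurrences B E n) _ ⟩
  ι (occurrences B E n) + ι (List.length (List.filter (occursAt? B E) (n ∷ [])))
    ≡⟨ cong₂ _+_ (ι-occurrences B E n) last ⟩
  ∑ (λ j → match (digits B) (λ t → E (j ℕ.+ t))) (suc n) ∎
  where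
  open ≡-Reasoning
  last : ι (List.length (List.filter (occursAt? B E) (n ∷ []))) ≡ match (digits B) (λ t → E (n ℕ.+ t))
  last = go (occursAt? B E n)
    where
    go : Dec (OccursAt B E n) →
         ι (List.length (List.filter (occursAt? B E) (n ∷ []))) ≡ match (digits B) (λ t → E (n ℕ.+ t))
    go (yes h) = trans (cong (ι ∘ List.length) (List.filter-accept (occursAt? B E) h))
      (sym (match-true B (λ t → E (n ℕ.+ t)) h))
    go (no ¬h) = trans (cong (ι ∘ List.length) (List.filter-reject (occursAt? B E) ¬h))
      (sym (fromInj₁ (λ h → contradiction h ¬h) (match-01 B (λ t → E (n ℕ.+ t)))))

∣p-q∣≤1 : ∀ {p q} → 0ℚ ≤ p → p ≤ 1ℚ → 0ℚ ≤ q → q ≤ 1ℚ → ∣ p - q ∣ ≤ 1ℚ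
∣p-q∣≤1 {p} {q} 0≤p p≤1 0≤q q≤1 with ℚ.∣p∣≡p∨∣p∣≡-p (p - q)
... | inj₁ eq rewrite eq = ℚ.+-mono-≤ p≤1 (ℚ.neg-antimono-≤ 0≤q)
... | inj₂ eq rewrite eq = subst (_≤ 1ℚ) (flip p q) (ℚ.+-mono-≤ q≤1 (ℚ.neg-antimono-≤ 0≤p))
  where
  flip : ∀ p q → q - p ≡ - (p - q)
  flip = Ring.solve-∀ ℚ-ring

-- The block C b w

applyUpTo-cong : ∀ {A : Set} {f g : ℕ → A} n → (∀ i → i ℕ.< n → f i ≡ g i) →
                 applyUpTo f n ≡ applyUpTo g n
applyUpTo-cong zero    eq = refl
applyUpTo-cong (suc n) eq = cong₂ _∷_ (eq 0 ℕ.z<s) (applyUpTo-cong n λ i i<n → eq (suc i) (ℕ.s<s i<n))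

applyUpTo-++ : ∀ {A : Set} (f : ℕ → A) m n →
               applyUpTo f (m ℕ.+ n) ≡ applyUpTo f m ++ applyUpTo (λ i → f (m ℕ.+ i)) n
applyUpTo-++ f zero    n = refl
applyUpTo-++ f (suc m) n = cong (f 0 ∷_) (applyUpTo-++ (f ∘ suc) m n)

concat-applyUpTo : ∀ {A : Set} (f : ℕ → A) m n →
  concat (applyUpTo (λ i → applyUpTo (λ j → f (i ℕ.* n ℕ.+ j)) n) m) ≡ applyUpTo f (m ℕ.* n)
concat-applyUpTo f zero    n = refl
concat-applyUpTo f (suc m) n = trans
  (cong (applyUpTo f n ++_) (trans
    (cong concat (applyUpTo-cong m λ i _ → applyUpTo-cong n λ j _ → cong f (ℕ.+-assoc n (i ℕ.* n) j)))
    (concat-applyUpTo (λ i → f (n ℕ.+ i)) m n)))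
  (sym (applyUpTo-++ f n (m ℕ.* n)))

replicate≡applyUpTo : ∀ {A : Set} (x : A) n → List.replicate n x ≡ applyUpTo (const x) n
replicate≡applyUpTo x zero    = refl
replicate≡applyUpTo x (suc n) = cong (x ∷_) (replicate≡applyUpTo x n)

tabulate≡applyUpTo : ∀ {A : Set} (f : ℕ → A) n → List.tabulate {n = n} (f ∘ toℕ) ≡ applyUpTo f n
tabulate≡applyUpTo f zero    = refl
tabulate≡applyUpTo f (suc n) = cong (f 0 ∷_) (tabulate≡applyUpTo (f ∘ suc) n)

copies-periodic : ∀ {A : Set} (f : ℕ → A) n → (∀ i j → f (i ℕ.* n ℕ.+ j) ≡ f j) →
                  ∀ m → copies m (applyUpTo f n) ≡ applyUpTo f (m ℕ.* n)
copies-periodic f n periodic m = begin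
  concat (List.replicate m (applyUpTo f n))
    ≡⟨ cong concat (replicate≡applyUpTo (applyUpTo f n) m) ⟩
  concat (applyUpTo (λ _ → applyUpTo f n) m)
    ≡⟨ cong concat (applyUpTo-cong m λ i _ → applyUpTo-cong n λ j _ → periodic i j) ⟨
  concat (applyUpTo (λ i → applyUpTo (λ j → f (i ℕ.* n ℕ.+ j)) n) m)
    ≡⟨ concat-applyUpTo f m n ⟩
  applyUpTo f (m ℕ.* n) ∎
  where open ≡-Reasoning

length-take-≤ : ∀ {A : Set} u (xs : List A) → length (take u xs) ℕ.≤ u
length-take-≤ u xs = subst (ℕ._≤ u) (sym (List.length-take u xs)) (ℕ.m⊓n≤m u (length xs))

length-drop-≤ : ∀ {A : Set} s u (xs : List A) → length xs ℕ.≤ s ℕ.+ u → length (drop u xs) ℕ.≤ s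
length-drop-≤ s u xs ≤s+u = subst (ℕ._≤ s) (sym (List.length-drop u xs))
  (ℕ.m≤n+o⇒m∸n≤o (length xs) u (subst (length xs ℕ.≤_) (ℕ.+-comm s u) ≤s+u))

-- Base-b digits of consecutive integers.

module Odometer (b : ℕ) .{{_ : NonZero b}} where

  infixl 7 _/^_

  -- Deletes the last u base-b digits of v.
  _/^_ : ℕ → ℕ → ℕ
  v /^ u = (v / b ^ u) {{ℕ.m^n≢0 b u}}

  /^-+ : ∀ v s u → v /^ (s ℕ.+ u) ≡ v /^ u /^ s
  /^-+ v s u = trans
    (/-congʳ {{ℕ.m^n≢0 b (s ℕ.+ u)}} {{nz}} (trans (ℕ.^-distribˡ-+-* b s u) (ℕ.*-comm (b ^ s) (b ^ u))))
    (sym (m/n/o≡m/[n*o] v (b ^ u) (b ^ s) {{ℕ.m^n≢0 b u}} {{ℕ.m^n≢0 b s}} {{nz}}))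
    where
    nz : NonZero (b ^ u ℕ.* b ^ s)
    nz = ℕ.m*n≢0 (b ^ u) (b ^ s) {{ℕ.m^n≢0 b u}} {{ℕ.m^n≢0 b s}}

  [cn+m]/n≡c+m/n : ∀ c m n .{{_ : NonZero n}} → (c ℕ.* n ℕ.+ m) / n ≡ c ℕ.+ m / n
  [cn+m]/n≡c+m/n c m n = trans (+-distrib-/-∣ˡ {c ℕ.* n} m (divides-refl c))
    (cong (ℕ._+ m / n) (m*n/n≡m c n))

  /^-carry : ∀ c m u → (c ℕ.* b ^ u ℕ.+ m) /^ u ≡ c ℕ.+ m /^ u
  /^-carry c m u = [cn+m]/n≡c+m/n c m (b ^ u) {{ℕ.m^n≢0 b u}}

  -- dig w v t is the digit with index t, counted from the most significant one, of
  -- the w-digit base-b representation of v mod b ^ w.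
  dig : ℕ → ℕ → ℕ → ℕ
  dig zero    v t       = 0
  dig (suc w) v zero    = (v /^ w) % b
  dig (suc w) v (suc t) = dig w v t

  dig-drop : ∀ s u v t → dig (s ℕ.+ u) v (s ℕ.+ t) ≡ dig u v t
  dig-drop zero    u v t = refl
  dig-drop (suc s) u v t = dig-drop s u v t

  dig-take : ∀ s u v t → t ℕ.< s → dig (s ℕ.+ u) v t ≡ dig s (v /^ u) t
  dig-take (suc s) u v (suc t) (s≤s t<s) = dig-take s u v t t<s
  dig-take (suc s) u v zero    _         = cong (_% b) (/^-+ v s u)

  -- Multiples of b^u do not affect the last u digits. In particular the word after the last one is
  -- again the word 0, which makes the counting cyclic.
  dig-periodic : ∀ u c v t → dig u (c ℕ.* b ^ u ℕ.+ v) t ≡ dig u v t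
  dig-periodic zero    c v t    = refl
  dig-periodic (suc u) c v zero = begin
    (c ℕ.* (b ℕ.* b ^ u) ℕ.+ v) /^ u % b     ≡⟨ cong (λ m → (m ℕ.+ v) /^ u % b) (ℕ.*-assoc c b (b ^ u)) ⟨
    (c ℕ.* b ℕ.* b ^ u ℕ.+ v) /^ u % b       ≡⟨ cong (_% b) (/^-carry (c ℕ.* b) v u) ⟩
    (c ℕ.* b ℕ.+ v /^ u) % b                 ≡⟨ cong (_% b) (ℕ.+-comm (c ℕ.* b) (v /^ u)) ⟩
    (v /^ u ℕ.+ c ℕ.* b) % b                 ≡⟨ [m+kn]%n≡m%n (v /^ u) c b ⟩
    v /^ u % b                               ∎
    where open ≡-Reasoning
  dig-periodic (suc u) c v (suc t) = trans
    (cong (λ m → dig u (m ℕ.+ v) t) (sym (ℕ.*-assoc c b (b ^ u))))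
    (dig-periodic u (c ℕ.* b) v t)

  dig-periodic₁ : ∀ u v t → dig u (b ^ u ℕ.+ v) t ≡ dig u v t
  dig-periodic₁ u v t = trans
    (cong (λ m → dig u (m ℕ.+ v) t) (sym (ℕ.*-identityˡ (b ^ u)))) (dig-periodic u 1 v t)

  dig-head : ∀ w d v → d ℕ.< b → v ℕ.< b ^ w → dig (suc w) (d ℕ.* b ^ w ℕ.+ v) 0 ≡ d
  dig-head w d v d<b v<b^w = begin
    (d ℕ.* b ^ w ℕ.+ v) /^ w % b   ≡⟨ cong (_% b) (/^-carry d v w) ⟩
    (d ℕ.+ v /^ w) % b             ≡⟨ cong (λ x → (d ℕ.+ x) % b) (m<n⇒m/n≡0 {{ℕ.m^n≢0 b w}} v<b^w) ⟩
    (d ℕ.+ 0) % b                     ≡⟨ cong (_% b) (ℕ.+-identityʳ d) ⟩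
    d % b                             ≡⟨ m<n⇒m%n≡m d<b ⟩
    d                                 ∎
    where open ≡-Reasoning

  -- Lexicographic order is numerical order: the word with first digit d and remaining word number v
  -- has number d b^w + v.
  words-dig : ∀ w → List.map (List.map toℕ ∘ Vec.toList) (words b w) ≡
                    applyUpTo (λ v → applyUpTo (dig w v) w) (b ^ w)
  words-dig zero    = refl
  words-dig (suc w) = begin
    List.map F (concatMap (λ d → List.map (d ∷_) (words b w)) (List.allFin b))
      ≡⟨ List.map-concatMap F (λ d → List.map (d ∷_) (words b w)) (List.allFin b) ⟩
    concatMap (λ d → List.map F (List.map (d ∷_) (words b w))) (List.allFin b)
      ≡⟨ List.concatMap-cong (λ d → trans (sym (List.map-∘ (words b w))) (trans (List.map-∘ (words b w))
           (cong (List.map (toℕ d ∷_)) (words-dig w)))) (List.allFin b) ⟩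
    concat (List.map (row ∘ toℕ) (List.allFin b))
      ≡⟨ cong concat (List.map-tabulate {n = b} id (row ∘ toℕ)) ⟩
    concat (List.tabulate {n = b} (row ∘ toℕ))
      ≡⟨ cong concat (tabulate≡applyUpTo row b) ⟩
    concat (applyUpTo row b)
      ≡⟨ cong concat (applyUpTo-cong b λ d d<b → trans (List.map-applyUpTo _ (d ∷_) (b ^ w))
           (applyUpTo-cong (b ^ w) λ v v<b^w → cong₂ _∷_ (sym (dig-head w d v d<b v<b^w))
             (applyUpTo-cong w λ t _ → sym (dig-periodic w d v t)))) ⟩
    concat (applyUpTo (λ d → applyUpTo (λ v → applyUpTo (dig (suc w) (d ℕ.* b ^ w ℕ.+ v)) (suc w)) (b ^ w)) b)
      ≡⟨ concat-applyUpTo (λ v → applyUpTo (dig (suc w) v) (suc w)) b (b ^ w) ⟩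
    applyUpTo (λ v → applyUpTo (dig (suc w) v) (suc w)) (b ^ suc w) ∎
    where
    open ≡-Reasoning
    F : ∀ {w} → Vec (Fin b) w → List ℕ
    F = List.map toℕ ∘ Vec.toList
    row : ℕ → List (List ℕ)
    row d = List.map (d ∷_) (applyUpTo (λ v → applyUpTo (dig w v) w) (b ^ w))

  -- Fixing the first |B| of u digits leaves b^(u-|B|) numbers. Multiplying by b^|B| states this
  -- without subtraction or division.
  count-prefix : ∀ u B → All (ℕ._< b) B → length B ℕ.≤ u →
                 ∑ (λ v → match B (dig u v)) (b ^ u) * ι (b ^ length B) ≡ ι (b ^ u)
  count-prefix u [] [] _ = begin
    ∑ (λ _ → 1ℚ) (b ^ u) * 1ℚ    ≡⟨ ℚ.*-identityʳ _ ⟩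
    ∑ (λ _ → 1ℚ) (b ^ u)         ≡⟨ ∑-const 1ℚ (b ^ u) ⟩
    ι (b ^ u) * 1ℚ               ≡⟨ ℚ.*-identityʳ _ ⟩
    ι (b ^ u)                    ∎
    where open ≡-Reasoning
  count-prefix (suc u) (d ∷ B) (d<b ∷ B<b) (s≤s ∣B∣≤u) = begin
    ∑ (λ v → match (d ∷ B) (dig (suc u) v)) (b ℕ.* b ^ u) * ι (b ℕ.* b ^ length B)
      -- Each number is written as e b^u + v with leading digit e; after the exchange of sums, the
      -- sum over e keeps only e = d.
      ≡⟨ cong (_* ι (b ℕ.* b ^ length B)) (trans
           (∑-nested (λ v → match (d ∷ B) (dig (suc u) v)) b (b ^ u))
           (∑-cong b λ e e<b → ∑-cong (b ^ u) λ v v<b^u →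
             cong₂ (λ x y → δ x d * y) (dig-head u e v e<b v<b^u)
               (match-cong B λ t _ → dig-periodic u e v t))) ⟩
    ∑ (λ e → ∑ (λ v → δ e d * match B (dig u v)) (b ^ u)) b * ι (b ℕ.* b ^ length B)
      ≡⟨ cong (_* ι (b ℕ.* b ^ length B)) (∑-swap (λ e v → δ e d * match B (dig u v)) b (b ^ u)) ⟩
    ∑ (λ v → ∑ (λ e → δ e d * match B (dig u v)) b) (b ^ u) * ι (b ℕ.* b ^ length B)
      ≡⟨ cong₂ _*_ (∑-cong (b ^ u) λ v _ → ∑-δ d (match B (dig u v)) b d<b) (ι-* b (b ^ length B)) ⟩
    X * (ι b * ι (b ^ length B))
      ≡⟨ regroup X (ι b) (ι (b ^ length B)) ⟩
    ι b * (X * ι (b ^ length B))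
      ≡⟨ cong (ι b *_) (count-prefix u B B<b ∣B∣≤u) ⟩
    ι b * ι (b ^ u)
      ≡⟨ ι-* b (b ^ u) ⟨
    ι (b ^ suc u) ∎
    where
    open ≡-Reasoning
    X = ∑ (λ v → match B (dig u v)) (b ^ u)
    regroup : ∀ x y z → x * (y * z) ≡ y * (x * z)
    regroup = Ring.solve-∀ ℚ-ring

  -- A window starting at offset s of a word v of length s + u reads the last u digits
  -- of v and then the first digits of the word v + 1.
  count-at-offset : ∀ s u B → All (ℕ._< b) B → length B ℕ.≤ s ℕ.+ u →
    ∑ (λ v → match (take u B) (dig u v) * match (drop u B) (dig (s ℕ.+ u) (suc v))) (b ^ (s ℕ.+ u))
      * ι (b ^ length B) ≡ ι (b ^ (s ℕ.+ u))
  count-at-offset s u B B<b ∣B∣≤s+u = begin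
    ∑ (λ v → match B₁ (dig u v) * match B₂ (dig (s ℕ.+ u) (suc v))) (b ^ (s ℕ.+ u)) * ι (b ^ length B)
      ≡⟨ cong₂ _*_ counted
           (cong ι (trans (cong (b ^_) lengths) (ℕ.^-distribˡ-+-* b (length B₁) (length B₂)))) ⟩
    Y * X * ι (b ^ length B₁ ℕ.* b ^ length B₂)
      ≡⟨ cong (Y * X *_) (ι-* (b ^ length B₁) (b ^ length B₂)) ⟩
    Y * X * (ι (b ^ length B₁) * ι (b ^ length B₂))
      ≡⟨ regroup Y X (ι (b ^ length B₁)) (ι (b ^ length B₂)) ⟩
    (X * ι (b ^ length B₂)) * (Y * ι (b ^ length B₁))
      ≡⟨ cong₂ _*_ (count-prefix s B₂ (All.drop⁺ u B<b) ∣B₂∣≤s) (count-prefix u B₁ (All.take⁺ u B<b) ∣B₁∣≤u) ⟩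
    ι (b ^ s) * ι (b ^ u)
      ≡⟨ ι-* (b ^ s) (b ^ u) ⟨
    ι (b ^ s ℕ.* b ^ u)
      ≡⟨ cong ι (ℕ.^-distribˡ-+-* b s u) ⟨
    ι (b ^ (s ℕ.+ u)) ∎
    where
    open ≡-Reasoning
    B₁ = take u B
    B₂ = drop u B
    X = ∑ (λ v → match B₂ (dig s v)) (b ^ s)
    Y = ∑ (λ v → match B₁ (dig u v)) (b ^ u)
    regroup : ∀ y x p q → y * x * (p * q) ≡ (x * q) * (y * p)
    regroup = Ring.solve-∀ ℚ-ring
    lengths : length B ≡ length B₁ ℕ.+ length B₂
    lengths = trans (cong length (sym (List.take++drop≡id u B))) (List.length-++ B₁)
    ∣B₁∣≤u : length B₁ ℕ.≤ u
    ∣B₁∣≤u = length-take-≤ u B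
    ∣B₂∣≤s : length B₂ ℕ.≤ s
    ∣B₂∣≤s = length-drop-≤ s u B ∣B∣≤s+u
    -- Adding 1 to x b^u + y raises the leading part x by the carry `suc y /^ u`, which for y < b^u
    -- is 1 if y = b^u - 1 and 0 otherwise.
    next : ∀ x y → suc (x ℕ.* b ^ u ℕ.+ y) /^ u ≡ x ℕ.+ suc y /^ u
    next x y = trans (cong (_/^ u) (sym (ℕ.+-suc (x ℕ.* b ^ u) y))) (/^-carry x (suc y) u)
    counted : ∑ (λ v → match B₁ (dig u v) * match B₂ (dig (s ℕ.+ u) (suc v))) (b ^ (s ℕ.+ u)) ≡ Y * X
    counted = begin
      ∑ (λ v → match B₁ (dig u v) * match B₂ (dig (s ℕ.+ u) (suc v))) (b ^ (s ℕ.+ u))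
        ≡⟨ cong (∑ _) (ℕ.^-distribˡ-+-* b s u) ⟩
      ∑ (λ v → match B₁ (dig u v) * match B₂ (dig (s ℕ.+ u) (suc v))) (b ^ s ℕ.* b ^ u)
        ≡⟨ ∑-nested _ (b ^ s) (b ^ u) ⟩
      ∑ (λ x → ∑ (λ y → match B₁ (dig u (x ℕ.* b ^ u ℕ.+ y))
                        * match B₂ (dig (s ℕ.+ u) (suc (x ℕ.* b ^ u ℕ.+ y)))) (b ^ u)) (b ^ s)
        ≡⟨ ∑-cong (b ^ s) (λ x _ → ∑-cong (b ^ u) λ y _ → trans
             (cong₂ _*_ (match-cong B₁ λ t _ → dig-periodic u x y t)
               (match-cong B₂ λ t t< → trans (dig-take s u _ t (ℕ.<-≤-trans t< ∣B₂∣≤s))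
                 (cong (λ v → dig s v t) (next x y))))
             (ℚ.*-comm (match B₁ (dig u y)) (match B₂ (dig s (x ℕ.+ suc y /^ u))))) ⟩
      ∑ (λ x → ∑ (λ y → match B₂ (dig s (x ℕ.+ suc y /^ u)) * match B₁ (dig u y)) (b ^ u)) (b ^ s)
        ≡⟨ ∑-swap (λ x y → match B₂ (dig s (x ℕ.+ suc y /^ u)) * match B₁ (dig u y)) (b ^ s) (b ^ u) ⟩
      ∑ (λ y → ∑ (λ x → match B₂ (dig s (x ℕ.+ suc y /^ u)) * match B₁ (dig u y)) (b ^ s)) (b ^ u)
        -- For fixed y the carry is a fixed shift of x. A sum over a full period b^s is invariant
        -- under it, so the two factors become independent.
        ≡⟨ ∑-cong (b ^ u) (λ y _ → trans
             (∑-distribʳ (λ x → match B₂ (dig s (x ℕ.+ suc y /^ u))) (match B₁ (dig u y)) (b ^ s))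
             (trans
               (cong (_* match B₁ (dig u y)) (∑-shift (λ x → match B₂ (dig s x)) (b ^ s)
                 (λ x → match-cong B₂ λ t _ → dig-periodic₁ s x t) (suc y /^ u)))
               (ℚ.*-comm X (match B₁ (dig u y))))) ⟩
      ∑ (λ y → match B₁ (dig u y) * X) (b ^ u)
        ≡⟨ ∑-distribʳ (λ y → match B₁ (dig u y)) X (b ^ u) ⟩
      Y * X ∎

  -- The periodic sequence of repeated copies of `C b w`.

  module Sequence (w : ℕ) .{{_ : NonZero w}} where

    opaque
      period : ℕ
      period = b ^ w ℕ.* w

      period≡ : period ≡ b ^ w ℕ.* w
      period≡ = refl

    -- Position p lies in word number p / w at offset p % w, so this is `C b w` repeated forever.
    seq : ℕ → ℕ
    seq p = dig w (p / w) (p % w)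

    seq-at : ∀ v s → s ℕ.< w → seq (v ℕ.* w ℕ.+ s) ≡ dig w v s
    seq-at v s s<w = cong₂ (dig w)
      (trans ([cn+m]/n≡c+m/n v s w) (trans (cong (v ℕ.+_) (m<n⇒m/n≡0 s<w)) (ℕ.+-identityʳ v)))
      (trans (cong (_% w) (ℕ.+-comm (v ℕ.* w) s)) (trans ([m+kn]%n≡m%n s v w) (m<n⇒m%n≡m s<w)))

    seq-periodic : ∀ i j → seq (i ℕ.* period ℕ.+ j) ≡ seq j
    seq-periodic i j = begin
      seq (i ℕ.* period ℕ.+ j)
        ≡⟨ cong (λ m → seq (m ℕ.+ j)) (trans (cong (i ℕ.*_) period≡) (sym (ℕ.*-assoc i (b ^ w) w))) ⟩
      dig w ((i ℕ.* b ^ w ℕ.* w ℕ.+ j) / w) ((i ℕ.* b ^ w ℕ.* w ℕ.+ j) % w)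
        ≡⟨ cong₂ (dig w) ([cn+m]/n≡c+m/n (i ℕ.* b ^ w) j w)
             (trans (cong (_% w) (ℕ.+-comm (i ℕ.* b ^ w ℕ.* w) j)) ([m+kn]%n≡m%n j (i ℕ.* b ^ w) w)) ⟩
      dig w (i ℕ.* b ^ w ℕ.+ j / w) (j % w)
        ≡⟨ dig-periodic w i (j / w) (j % w) ⟩
      dig w (j / w) (j % w) ∎
      where open ≡-Reasoning

    C-seq : List.map toℕ (C b w) ≡ applyUpTo seq period
    C-seq = begin
      List.map toℕ (concatMap Vec.toList (words b w))
        ≡⟨ List.map-concatMap toℕ Vec.toList (words b w) ⟩
      concat (List.map (List.map toℕ ∘ Vec.toList) (words b w))
        ≡⟨ cong concat (words-dig w) ⟩
      concat (applyUpTo (λ v → applyUpTo (dig w v) w) (b ^ w))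
        ≡⟨ cong concat (applyUpTo-cong (b ^ w) λ v _ → applyUpTo-cong w λ s s<w → seq-at v s s<w) ⟨
      concat (applyUpTo (λ v → applyUpTo (λ s → seq (v ℕ.* w ℕ.+ s)) w) (b ^ w))
        ≡⟨ concat-applyUpTo seq (b ^ w) w ⟩
      applyUpTo seq (b ^ w ℕ.* w)
        ≡⟨ cong (applyUpTo seq) period≡ ⟨
      applyUpTo seq period ∎
      where open ≡-Reasoning

    length-C : length (C b w) ≡ period
    length-C = trans (sym (List.length-map toℕ (C b w)))
      (trans (cong length C-seq) (List.length-applyUpTo seq period))

    copies-C-seq : ∀ m → List.map toℕ (copies m (C b w)) ≡ applyUpTo seq (m ℕ.* period)
    copies-C-seq m = begin
      List.map toℕ (concat (List.replicate m (C b w)))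
        ≡⟨ List.concat-map (List.replicate m (C b w)) ⟨
      concat (List.map (List.map toℕ) (List.replicate m (C b w)))
        ≡⟨ cong concat (List.map-replicate (List.map toℕ) m (C b w)) ⟩
      copies m (List.map toℕ (C b w))
        ≡⟨ cong (copies m) C-seq ⟩
      copies m (applyUpTo seq period)
        ≡⟨ copies-periodic seq period seq-periodic m ⟩
      applyUpTo seq (m ℕ.* period) ∎
      where open ≡-Reasoning

    window-seq : ∀ B s u → s ℕ.+ u ≡ w → s ℕ.< w → length B ℕ.≤ w → ∀ v →
      match B (λ t → seq (v ℕ.* w ℕ.+ s ℕ.+ t)) ≡
      match (take u B) (dig u v) * match (drop u B) (dig w (suc v))
    window-seq B s u refl s<w ∣B∣≤w v = trans (match-split u B _) (cong₂ _*_
      (match-cong (take u B) λ t t< → begin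
        seq (v ℕ.* w ℕ.+ s ℕ.+ t)      ≡⟨ cong seq (ℕ.+-assoc (v ℕ.* w) s t) ⟩
        seq (v ℕ.* w ℕ.+ (s ℕ.+ t))    ≡⟨ seq-at v (s ℕ.+ t) (ℕ.+-monoʳ-< s (ℕ.<-≤-trans t< (length-take-≤ u B))) ⟩
        dig w v (s ℕ.+ t)              ≡⟨ dig-drop s u v t ⟩
        dig u v t                      ∎)
      -- Since s + u = w, the window crosses into word v + 1 after u digits; its remaining part has
      -- length at most s < w and so stays in that word.
      (match-cong (drop u B) λ t t< → begin
        seq (v ℕ.* w ℕ.+ s ℕ.+ (u ℕ.+ t))  ≡⟨ cong seq (regroup (v ℕ.* w) s u t) ⟩
        seq (suc v ℕ.* w ℕ.+ t)            ≡⟨ seq-at (suc v) t (ℕ.<-trans (ℕ.<-≤-trans t< (length-drop-≤ s u B ∣B∣≤w)) s<w) ⟩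
        dig w (suc v) t                    ∎))
      where
      open ≡-Reasoning
      regroup : ∀ x s u t → x ℕ.+ s ℕ.+ (u ℕ.+ t) ≡ s ℕ.+ u ℕ.+ x ℕ.+ t
      regroup = solve-∀

    -- The starting positions are sorted by their offset s in a word. Each of the w offsets
    -- contributes b^w / b^|B| occurrences.
    count-period : ∀ B → All (ℕ._< b) B → length B ℕ.≤ w →
      ∑ (λ p → match B (λ t → seq (p ℕ.+ t))) period * ι (b ^ length B) ≡ ι period
    count-period B B<b ∣B∣≤w = begin
      ∑ (λ p → match B (λ t → seq (p ℕ.+ t))) period * κ
        ≡⟨ cong (λ n → ∑ (λ p → match B (λ t → seq (p ℕ.+ t))) n * κ) period≡ ⟩
      ∑ (λ p → match B (λ t → seq (p ℕ.+ t))) (b ^ w ℕ.* w) * κ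
        ≡⟨ cong (_* κ) (trans (∑-nested (λ p → match B (λ t → seq (p ℕ.+ t))) (b ^ w) w)
             (∑-swap (λ v s → match B (λ t → seq (v ℕ.* w ℕ.+ s ℕ.+ t))) (b ^ w) w)) ⟩
      ∑ (λ s → ∑ (λ v → match B (λ t → seq (v ℕ.* w ℕ.+ s ℕ.+ t))) (b ^ w)) w * κ
        ≡⟨ ∑-distribʳ _ κ w ⟨
      ∑ (λ s → ∑ (λ v → match B (λ t → seq (v ℕ.* w ℕ.+ s ℕ.+ t))) (b ^ w) * κ) w
        ≡⟨ ∑-cong w (λ s s<w → at-offset s (w ∸ s) (ℕ.m+[n∸m]≡n (ℕ.<⇒≤ s<w)) s<w) ⟩
      ∑ (λ _ → ι (b ^ w)) w
        ≡⟨ ∑-const (ι (b ^ w)) w ⟩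
      ι w * ι (b ^ w)
        ≡⟨ ι-* w (b ^ w) ⟨
      ι (w ℕ.* b ^ w)
        ≡⟨ cong ι (trans (ℕ.*-comm w (b ^ w)) (sym period≡)) ⟩
      ι period ∎
      where
      open ≡-Reasoning
      κ = ι (b ^ length B)
      at-offset : ∀ s u → s ℕ.+ u ≡ w → s ℕ.< w →
        ∑ (λ v → match B (λ t → seq (v ℕ.* w ℕ.+ s ℕ.+ t))) (b ^ w) * κ ≡ ι (b ^ w)
      at-offset s u eq s<w = trans
        (cong (_* κ) (∑-cong (b ^ w) λ v _ → window-seq B s u eq s<w ∣B∣≤w v))
        (helper eq)
        where
        helper : s ℕ.+ u ≡ w →
          ∑ (λ v → match (take u B) (dig u v) * match (drop u B) (dig w (suc v))) (b ^ w) * κ ≡ ι (b ^ w)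
        helper refl = count-at-offset s u B B<b ∣B∣≤w

-- The segments of the example

-- Lookup made total by the default 0. Its type does not mention the list, so it can be rewritten
-- along equations between lists and between values of `locate`.
entry : List ℕ → ℕ → ℕ
entry []       n       = 0
entry (x ∷ xs) zero    = x
entry (x ∷ xs) (suc n) = entry xs n

entry-lookup : ∀ {b} (xs : List (Fin b)) n .(n< : n ℕ.< length xs) →
               toℕ (List.lookup xs (fromℕ< n<)) ≡ entry (List.map toℕ xs) n
entry-lookup (x ∷ xs) zero    n< = refl
entry-lookup (x ∷ xs) (suc n) n< = entry-lookup xs n (ℕ.s<s⁻¹ n<)

entry-applyUpTo : ∀ f m n → n ℕ.< m → entry (applyUpTo f m) n ≡ f n
entry-applyUpTo f (suc m) zero    n<m = refl
entry-applyUpTo f (suc m) (suc n) n<m = entry-applyUpTo (f ∘ suc) m n (ℕ.s<s⁻¹ n<m)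

exampleE-entry : ∀ n → let j = suc (Location.i (locate n)) in
  exampleE n ≡ entry (List.map toℕ (copies (mult j) (block j))) (n ∸ L (Location.i (locate n)))
exampleE-entry n = entry-lookup (copies (mult j) (block j)) (n ∸ L (Location.i (locate n))) _
  where j = suc (Location.i (locate n))

L-mono : ∀ {i j} → i ℕ.≤ j → L i ℕ.≤ L j
L-mono {i} {j} i≤j = subst (λ j → L i ℕ.≤ L j) (ℕ.m∸n+n≡m i≤j) (go (j ∸ i))
  where
  go : ∀ d → L i ℕ.≤ L (d ℕ.+ i)
  go zero    = ℕ.≤-refl
  go (suc d) = ℕ.≤-trans (go d) (ℕ.m≤m+n (L (d ℕ.+ i)) _)

L-cancel-< : ∀ {i j n} → L i ℕ.≤ n → n ℕ.< L j → i ℕ.< j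
L-cancel-< Li≤n n<Lj = ℕ.≰⇒> λ j≤i → ℕ.<⇒≱ n<Lj (ℕ.≤-trans (L-mono j≤i) Li≤n)

locate-≤ : ∀ {n a} → n ℕ.< L (suc a) → Location.i (locate n) ℕ.≤ a
locate-≤ {n} n<L = ℕ.s≤s⁻¹ (L-cancel-< (Location.lower (locate n)) n<L)

locate-≥ : ∀ {n a} → L a ℕ.≤ n → a ℕ.≤ Location.i (locate n)
locate-≥ {n} L≤n = ℕ.s≤s⁻¹ (L-cancel-< L≤n (Location.upper (locate n)))

-- The copies of x_{i+2}, in base i + 2. The index is shifted by two because l_1 = 0 leaves x_1
-- without copies.
module Segment (i : ℕ) where

  b w : ℕ
  b = suc (suc i)
  w = b ^ 2

  instance
    w≢0 : NonZero w
    w≢0 = ℕ.m^n≢0 b 2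

  open Odometer b public
  open Sequence w public

  opaque
    M : ℕ
    M = mult b

    M≡ : M ≡ b ^ (3 ℕ.* b)
    M≡ = refl

  origin : ℕ
  origin = L (suc i)

  opaque
    unfolding M

    L-suc : L (suc (suc i)) ≡ origin ℕ.+ M ℕ.* period
    L-suc = cong (λ l → origin ℕ.+ M ℕ.* l) length-C

  opaque
    unfolding M

    copies-segment : List.map toℕ (copies (mult b) (block b)) ≡ applyUpTo seq (M ℕ.* period)
    copies-segment = copies-C-seq M

  located : ∀ {p} → p ℕ.< M ℕ.* period → Location.i (locate (origin ℕ.+ p)) ≡ suc i
  located {p} p< = ℕ.≤-antisym
    (locate-≤ (subst (origin ℕ.+ p ℕ.<_) (sym L-suc) (ℕ.+-monoʳ-< origin p<)))
    (locate-≥ (ℕ.m≤m+n origin p))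

  q-segment : ∀ {p} → p ℕ.< M ℕ.* period → q exampleQ (origin ℕ.+ p) ≡ b
  q-segment p< = cong (base ∘ suc) (located p<)

  E-segment : ∀ {p} → p ℕ.< M ℕ.* period → exampleE (origin ℕ.+ p) ≡ seq p
  E-segment {p} p< = begin
    exampleE (origin ℕ.+ p)
      ≡⟨ exampleE-entry (origin ℕ.+ p) ⟩
    entryAt (Location.i (locate (origin ℕ.+ p)))
      ≡⟨ cong entryAt (located p<) ⟩
    entryAt (suc i)
      ≡⟨ cong₂ entry copies-segment (ℕ.m+n∸m≡n origin p) ⟩
    entry (applyUpTo seq (M ℕ.* period)) p
      ≡⟨ entry-applyUpTo seq (M ℕ.* period) p p< ⟩
    seq p ∎
    where
    open ≡-Reasoning
    entryAt : ℕ → ℕ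
    entryAt i = entry (List.map toℕ (copies (mult (suc i)) (block (suc i)))) (origin ℕ.+ p ∸ L i)

  w≤period : w ℕ.≤ period
  w≤period = subst (w ℕ.≤_) (sym period≡) (ℕ.m≤n*m w (b ^ w) {{ℕ.m^n≢0 b w}})

  i<w : i ℕ.< w
  i<w = ℕ.≤-trans (ℕ.n≤1+n (suc i)) (ℕ.m≤m*n b (b ^ 1) {{ℕ.m^n≢0 b 1}})

  1≤M : 1 ℕ.≤ M
  1≤M = subst (1 ℕ.≤_) (sym M≡) (ℕ.m^n>0 b (3 ℕ.* b))

  period≤length : period ℕ.≤ M ℕ.* period
  period≤length = ℕ.m≤n*m period M {{ℕ.>-nonZero 1≤M}}

  0<length : 0 ℕ.< M ℕ.* period
  0<length = ℕ.<-≤-trans (ℕ.≤-<-trans ℕ.z≤n i<w) (ℕ.≤-trans w≤period period≤length)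

  -- The first word of `C b w` is 0...0. These zeros show both that the expansion does not end in
  -- maximal digits and that x < 1.
  E-start : exampleE (origin ℕ.+ 0) ≡ 0
  E-start = trans (E-segment 0<length) seq-0
    where
    dig-0 : ∀ w t → dig w 0 t ≡ 0
    dig-0 zero    t       = refl
    dig-0 (suc w) zero    = cong (ℕ._% b) (0/n≡0 (b ^ w) {{ℕ.m^n≢0 b w}})
    dig-0 (suc w) (suc t) = dig-0 w t
    seq-0 : seq 0 ≡ 0
    seq-0 = trans (cong (λ v → dig w v (0 ℕ.% w)) (0/n≡0 w)) (dig-0 w (0 ℕ.% w))

-- Estimates for products, reciprocals and sums.

∏-const : ∀ f c n → (∀ i → i ℕ.< n → f i ≡ c) → ∏ f n ≡ c ^ n
∏-const f c zero    eq = refl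
∏-const f c (suc n) eq = trans
  (cong₂ ℕ._*_ (∏-const f c n λ i i<n → eq i (ℕ.m<n⇒m<1+n i<n)) (eq n (ℕ.n<1+n n)))
  (ℕ.*-comm (c ^ n) c)

∏-≤ : ∀ f c n → (∀ i → i ℕ.< n → f i ℕ.≤ c) → ∏ f n ℕ.≤ c ^ n
∏-≤ f c zero    f≤c = ℕ.≤-refl
∏-≤ f c (suc n) f≤c = ℕ.≤-trans
  (ℕ.*-mono-≤ (∏-≤ f c n λ i i<n → f≤c i (ℕ.m<n⇒m<1+n i<n)) (f≤c n (ℕ.n<1+n n)))
  (ℕ.≤-reflexive (ℕ.*-comm (c ^ n) c))

recip-cong : ∀ {m n} .{{_ : NonZero m}} .{{_ : NonZero n}} → m ≡ n → recip m ≡ recip n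
recip-cong refl = refl

recip-anti-≤ : ∀ {m n} .{{_ : NonZero m}} .{{_ : NonZero n}} → m ℕ.≤ n → recip n ≤ recip m
recip-anti-≤ {m} {n} m≤n = begin
  recip n                      ≡⟨ ℚ.*-identityʳ (recip n) ⟨
  recip n * 1ℚ                 ≡⟨ cong (recip n *_) (recip-inverse m) ⟨
  recip n * (recip m * ι m)    ≤⟨ ℚ.*-monoˡ-≤-nonNeg (recip n) {{ℚ.nonNegative (0≤recip n)}}
                                    (ℚ.*-monoˡ-≤-nonNeg (recip m) {{ℚ.nonNegative (0≤recip m)}} (ι-mono m≤n)) ⟩
  recip n * (recip m * ι n)    ≡⟨ regroup (recip n) (recip m) (ι n) ⟩
  recip m * (recip n * ι n)    ≡⟨ cong (recip m *_) (recip-inverse n) ⟩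
  recip m * 1ℚ                 ≡⟨ ℚ.*-identityʳ (recip m) ⟩
  recip m                      ∎
  where
  open ℚ.≤-Reasoning
  regroup : ∀ x y z → x * (y * z) ≡ y * (x * z)
  regroup = Ring.solve-∀ ℚ-ring

∑-mono-≤ : ∀ {f g} n → (∀ i → i ℕ.< n → f i ≤ g i) → ∑ f n ≤ ∑ g n
∑-mono-≤ zero    f≤g = ℚ.≤-refl
∑-mono-≤ (suc n) f≤g = ℚ.+-mono-≤ (∑-mono-≤ n λ i i<n → f≤g i (ℕ.m<n⇒m<1+n i<n)) (f≤g n (ℕ.n<1+n n))

∑-monoʳ-≤ : ∀ {f} → (∀ i → 0ℚ ≤ f i) → ∀ {m n} → m ℕ.≤ n → ∑ f m ≤ ∑ f n
∑-monoʳ-≤ {f} 0≤f {m} {n} m≤n = subst (∑ f m ≤_)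
  (trans (sym (∑-split f m (n ∸ m))) (cong (∑ f) (ℕ.m+[n∸m]≡n m≤n)))
  (p≤p+q (∑ f m) (∑-nonNeg (λ i → f (m ℕ.+ i)) (λ i → 0≤f (m ℕ.+ i)) (n ∸ m)))

digits-< : ∀ {b c k} → b ℕ.≤ c → (B : Block b k) → All (ℕ._< c) (digits B)
digits-< b≤c []      = []
digits-< b≤c (d ∷ B) = ℕ.<-≤-trans (Fin.toℕ<n d) b≤c ∷ digits-< b≤c B

-- Division with remainder in which the remainder may equal P and the quotient is capped at m: a
-- cutoff at the very end of m + 1 copies is assigned to the last copy instead of completing it.
division : ∀ m P n → n ℕ.≤ suc m ℕ.* P → ∃ λ c → ∃ λ r → n ≡ c ℕ.* P ℕ.+ r × c ℕ.≤ m × r ℕ.≤ P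
division zero    P n n≤ = 0 , n , refl , ℕ.z≤n , subst (n ℕ.≤_) (ℕ.*-identityˡ P) n≤
division (suc m) P n n≤ with n ℕ.≤? suc m ℕ.* P
... | yes n≤′ with division m P n n≤′
...   | c , r , eq , c≤m , r≤P = c , r , eq , ℕ.m≤n⇒m≤1+n c≤m , r≤P
division (suc m) P n n≤ | no n≰ = suc m , n ∸ suc m ℕ.* P
  , sym (ℕ.m+[n∸m]≡n (ℕ.<⇒≤ (ℕ.≰⇒> n≰)))
  , ℕ.≤-refl
  , ℕ.m≤n+o⇒m∸n≤o n (suc m ℕ.* P) (subst (n ℕ.≤_) (ℕ.+-comm P (suc m ℕ.* P)) n≤)

-- Discrepancy between occurrences and weight within a segment.

module Discrepancy {β k : ℕ} (B : Block β k) where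

  g : ℕ → ℚ
  g j = match (digits B) (λ t → exampleE (j ℕ.+ t)) - over 1 exampleQ j k

  g≤1 : ∀ j → ∣ g j ∣ ≤ 1ℚ
  g≤1 j = ∣p-q∣≤1 (proj₁ (0≤match≤1 B _)) (proj₂ (0≤match≤1 B _))
    (over-nonNeg 1 exampleQ j k) (recip≤1 (window exampleQ j k) {{window-nonZero exampleQ j k}})

  occurrences-weight : ∀ n → ι (occurrences B exampleE n) - weight exampleQ k n ≡ ∑ g n
  occurrences-weight n = begin
    ι (occurrences B exampleE n) - weight exampleQ k n
      ≡⟨ cong₂ _+_ (ι-occurrences B exampleE n) (sym (∑-neg (λ j → over 1 exampleQ j k) n)) ⟩
    ∑ (λ j → match (digits B) (λ t → exampleE (j ℕ.+ t))) n + ∑ (λ j → - over 1 exampleQ j k) n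
      ≡⟨ ∑-+ (λ j → match (digits B) (λ t → exampleE (j ℕ.+ t))) (λ j → - over 1 exampleQ j k) n ⟨
    ∑ g n ∎
    where open ≡-Reasoning

  module _ (i : ℕ) (β≤i : β ℕ.≤ i) (k≤i : k ℕ.≤ i) where
    open Segment i

    private
      instance
        b^k≢0 : NonZero (b ^ k)
        b^k≢0 = ℕ.m^n≢0 b k

    k≤w : k ℕ.≤ w
    k≤w = ℕ.≤-trans k≤i (ℕ.<⇒≤ i<w)

    -- The model of `g` for the purely periodic sequence with constant base b.
    h : ℕ → ℚ
    h p = match (digits B) (λ t → seq (p ℕ.+ t)) - recip (b ^ k)

    ∑h-period : ∑ h period ≡ 0ℚ
    ∑h-period = begin
      ∑ h period
        ≡⟨ ∑-+ (λ p → match (digits B) (λ t → seq (p ℕ.+ t))) (λ _ → - r) period ⟩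
      c + ∑ (λ _ → - r) period
        ≡⟨ cong (c +_) (∑-const (- r) period) ⟩
      c + ι period * - r
        ≡⟨ cong (λ x → c + x * - r) counted ⟨
      c + c * ι (b ^ k) * - r
        ≡⟨ regroup c (ι (b ^ k)) r ⟩
      c - c * (r * ι (b ^ k))
        ≡⟨ cong (λ x → c - c * x) (recip-inverse (b ^ k)) ⟩
      c - c * 1ℚ
        ≡⟨ cong (λ x → c - x) (ℚ.*-identityʳ c) ⟩
      c - c
        ≡⟨ ℚ.+-inverseʳ c ⟩
      0ℚ ∎
      where
      open ≡-Reasoning
      r = recip (b ^ k)
      c = ∑ (λ p → match (digits B) (λ t → seq (p ℕ.+ t))) period
      counted : c * ι (b ^ k) ≡ ι period
      counted = subst (λ l → c * ι (b ^ l) ≡ ι period) (length-digits B)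
        (count-period (digits B) (digits-< (ℕ.≤-trans β≤i (ℕ.m≤n+m i 2)) B)
          (subst (ℕ._≤ w) (sym (length-digits B)) k≤w))
      regroup : ∀ c x r → c + c * x * - r ≡ c - c * (r * x)
      regroup = Ring.solve-∀ ℚ-ring

    ∑h-periods : ∀ c → ∑ h (c ℕ.* period) ≡ 0ℚ
    ∑h-periods c = trans (∑-nested h c period) (∑-zero c λ i _ → trans
      (∑-cong period λ j _ → cong (_- recip (b ^ k)) (match-cong (digits B) λ t _ →
        trans (cong seq (ℕ.+-assoc (i ℕ.* period) j t)) (seq-periodic i (j ℕ.+ t))))
      ∑h-period)

    -- A window lying wholly inside the segment reads only digits of `seq`, and all k bases in its
    -- weight equal b.
    g≡h : ∀ {p} → p ℕ.+ k ℕ.≤ M ℕ.* period → g (origin ℕ.+ p) ≡ h p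
    g≡h {p} p+k≤ = cong₂ _-_
      (match-cong (digits B) λ t t< → trans (cong exampleE (ℕ.+-assoc origin p t))
        (E-segment (inside t (subst (t ℕ.<_) (length-digits B) t<))))
      (recip-cong {{window-nonZero exampleQ (origin ℕ.+ p) k}}
        (∏-const (λ t → q exampleQ (origin ℕ.+ p ℕ.+ t)) b k λ t t<k →
          trans (cong (q exampleQ) (ℕ.+-assoc origin p t)) (q-segment (inside t t<k))))
      where
      inside : ∀ t → t ℕ.< k → p ℕ.+ t ℕ.< M ℕ.* period
      inside t t<k = ℕ.<-≤-trans (ℕ.+-monoʳ-< p t<k) p+k≤

    -- The whole copies before the cutoff cancel exactly. What remains lies within one copy, and
    -- each of its positions contributes at most 1.
    segment-bound : ∀ n → n ℕ.≤ M ℕ.* period → ∣ ∑ (λ p → g (origin ℕ.+ p)) n ∣ ≤ ι period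
    -- The cap M - 1 on the quotient guarantees a further copy after the c cancelled ones, so
    -- windows that overhang them by at most k ≤ `period` remain in the segment.
    segment-bound n n≤ with division (ℕ.pred M) period n
      (subst (λ m → n ℕ.≤ m ℕ.* period) (sym (ℕ.suc-pred M {{ℕ.>-nonZero 1≤M}})) n≤)
    ... | c , r , refl , c≤ , r≤P = begin
      ∣ ∑ (λ p → g (origin ℕ.+ p)) (c ℕ.* period ℕ.+ r) ∣
        ≡⟨ cong ∣_∣ (∑-split (λ p → g (origin ℕ.+ p)) (c ℕ.* period) r) ⟩
      ∣ ∑ (λ p → g (origin ℕ.+ p)) (c ℕ.* period) + rest ∣
        ≡⟨ cong (λ x → ∣ x + rest ∣)
             (trans (∑-cong (c ℕ.* period) λ p p< → g≡h (inside p p<)) (∑h-periods c)) ⟩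
      ∣ 0ℚ + rest ∣
        ≡⟨ cong ∣_∣ (ℚ.+-identityˡ rest) ⟩
      ∣ rest ∣
        ≤⟨ ∑-abs _ r (λ p → g≤1 (origin ℕ.+ (c ℕ.* period ℕ.+ p))) ⟩
      ι r
        ≤⟨ ι-mono r≤P ⟩
      ι period ∎
      where
      open ℚ.≤-Reasoning
      rest = ∑ (λ p → g (origin ℕ.+ (c ℕ.* period ℕ.+ p))) r
      inside : ∀ p → p ℕ.< c ℕ.* period → p ℕ.+ k ℕ.≤ M ℕ.* period
      inside p p< = ℕ.≤-trans
        (ℕ.+-mono-≤ (ℕ.<⇒≤ p<) (ℕ.≤-trans k≤w w≤period))
        (subst₂ (λ x m → x ℕ.≤ m ℕ.* period) (ℕ.+-comm period (c ℕ.* period))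
          (ℕ.suc-pred M {{ℕ.>-nonZero 1≤M}})
          (ℕ.*-monoˡ-≤ period (ℕ.s≤s c≤)))

-- From discrepancy bounds to ratios.

∣p÷q-1∣<ε : ∀ p q {ε} .{{_ : ℚ.NonZero q}} → 0ℚ < q → ∣ p - q ∣ < ε * q → ∣ p ÷ q - 1ℚ ∣ < ε
∣p÷q-1∣<ε p q {ε} 0<q bound = begin-strict
  ∣ p * 1/ q - 1ℚ ∣            ≡⟨ cong (λ x → ∣ p * 1/ q - x ∣) (ℚ.*-inverseʳ q) ⟨
  ∣ p * 1/ q - q * 1/ q ∣      ≡⟨ cong ∣_∣ (regroup p q (1/ q)) ⟨
  ∣ (p - q) * 1/ q ∣           ≡⟨ ℚ.∣p*q∣≡∣p∣*∣q∣ (p - q) (1/ q) ⟩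
  ∣ p - q ∣ * ∣ 1/ q ∣         ≡⟨ cong (∣ p - q ∣ *_) (ℚ.0≤p⇒∣p∣≡p (ℚ.<⇒≤ (ℚ.positive⁻¹ (1/ q) {{0<1/q}}))) ⟩
  ∣ p - q ∣ * 1/ q             <⟨ ℚ.*-monoˡ-<-pos (1/ q) {{0<1/q}} bound ⟩
  ε * q * 1/ q                 ≡⟨ ℚ.*-assoc ε q (1/ q) ⟩
  ε * (q * 1/ q)               ≡⟨ cong (ε *_) (ℚ.*-inverseʳ q) ⟩
  ε * 1ℚ                       ≡⟨ ℚ.*-identityʳ ε ⟩
  ε                            ∎
  where
  open ℚ.≤-Reasoning
  0<1/q : ℚ.Positive (1/ q)
  0<1/q = ℚ.1/pos⇒pos q {{ℚ.positive 0<q}}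
  regroup : ∀ p q r → (p - q) * r ≡ p * r - q * r
  regroup = Ring.solve-∀ ℚ-ring

-- In the application R bounds the discrepancy, W is the weight, N a number of positions and 1/K a
-- lower bound for the weight of each: R ≤ N/(mK) ≤ W/m.
ι≤recip* : ∀ {m K R N W} .{{_ : NonZero m}} .{{_ : NonZero K}} →
           m ℕ.* (K ℕ.* R) ℕ.≤ N → ι N * recip K ≤ W → ι R ≤ recip m * W
ι≤recip* {m} {K} {R} {N} {W} mKR≤N NK≤W = begin
  ι R
    ≡⟨ ℚ.*-identityʳ (ι R) ⟨
  ι R * 1ℚ
    ≡⟨ cong (ι R *_) (cong₂ _*_ (recip-inverse m) (recip-inverse K)) ⟨
  ι R * ((recip m * ι m) * (recip K * ι K))
    ≡⟨ regroup (ι R) (recip m) (ι m) (recip K) (ι K) ⟩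
  recip m * (ι m * (ι K * ι R) * recip K)
    ≡⟨ cong (λ x → recip m * (x * recip K)) (trans (ι-* m (K ℕ.* R)) (cong (ι m *_) (ι-* K R))) ⟨
  recip m * (ι (m ℕ.* (K ℕ.* R)) * recip K)
    ≤⟨ ℚ.*-monoˡ-≤-nonNeg (recip m) {{ℚ.nonNegative (0≤recip m)}}
         (ℚ.≤-trans (ℚ.*-monoʳ-≤-nonNeg (recip K) {{ℚ.nonNegative (0≤recip K)}} (ι-mono mKR≤N)) NK≤W) ⟩
  recip m * W ∎
  where
  open ℚ.≤-Reasoning
  regroup : ∀ r m′ m k′ k → r * ((m′ * m) * (k′ * k)) ≡ m′ * (m * (k * r) * k′)
  regroup = Ring.solve-∀ ℚ-ring

E<q : ∀ n → exampleE n ℕ.< q exampleQ n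
E<q n = Fin.toℕ<n (digit n)

period : ℕ → ℕ
period i = Segment.period i

period-mono : ∀ i → period i ℕ.≤ period (suc i)
period-mono i = subst₂ ℕ._≤_ (sym (Segment.period≡ i)) (sym (Segment.period≡ (suc i)))
  (ℕ.*-mono-≤
    (ℕ.≤-trans (ℕ.^-monoˡ-≤ (b ^ 2) b≤) (ℕ.^-monoʳ-≤ (suc b) (ℕ.^-monoˡ-≤ 2 b≤)))
    (ℕ.^-monoˡ-≤ 2 b≤))
  where
  b = suc (suc i)
  b≤ : b ℕ.≤ suc b
  b≤ = ℕ.n≤1+n b

next-period-negligible : ∀ m k c → ∃ λ A → ∀ i → A ℕ.≤ i →
  m ℕ.* (suc (suc (suc i)) ^ k ℕ.* (c ℕ.+ suc (suc (suc i)) ℕ.* period (suc i)))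
    ℕ.≤ Segment.M i ℕ.* period i
next-period-negligible m k c = let A , bound = period-negligible m k c in A , λ i A≤i →
  rename (Segment.b i) (Segment.b (suc i)) refl (Segment.M≡ i) (Segment.period≡ i) (Segment.period≡ (suc i))
    (bound (Segment.b i) (ℕ.m≤n⇒m≤1+n (ℕ.m≤n⇒m≤1+n A≤i)))
  where
  -- `M` and `period` are opaque, so their values are substituted through equations.
  rename : ∀ a a′ {M P P′} → a′ ≡ suc a →
    M ≡ a ^ (3 ℕ.* a) → P ≡ a ^ (a ^ 2) ℕ.* a ^ 2 → P′ ≡ a′ ^ (a′ ^ 2) ℕ.* a′ ^ 2 →
    m ℕ.* (suc a ^ k ℕ.* (c ℕ.+ suc a ℕ.* (suc a ^ (suc a ^ 2) ℕ.* suc a ^ 2)))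
      ℕ.≤ a ^ (3 ℕ.* a) ℕ.* (a ^ (a ^ 2) ℕ.* a ^ 2) →
    m ℕ.* (a′ ^ k ℕ.* (c ℕ.+ a′ ℕ.* P′)) ℕ.≤ M ℕ.* P
  rename a _ refl refl refl refl bound = bound

-- Convergence of the normality ratio for a fixed block.

module _ {β k : ℕ} (B : Block β k) where
  open Discrepancy B

  -- From segment i₀ on, every digit of B is below the base and k does not exceed the word length w.
  i₀ : ℕ
  i₀ = β ℕ.+ k

  β≤ : ∀ {i} → i₀ ℕ.≤ i → β ℕ.≤ i
  β≤ = ℕ.≤-trans (ℕ.m≤m+n β k)

  k≤ : ∀ {i} → i₀ ℕ.≤ i → k ℕ.≤ i
  k≤ = ℕ.≤-trans (ℕ.m≤n+m k β)

  partial-bound : ∀ i n → i₀ ℕ.≤ i → n ℕ.≤ Segment.M i ℕ.* period i → ∀ c →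
    ∣ ∑ g (L (suc i)) ∣ ≤ ι c → ∣ ∑ g (L (suc i) ℕ.+ n) ∣ ≤ ι (c ℕ.+ period i)
  partial-bound i n i₀≤i n≤ c bound = begin
    ∣ ∑ g (L (suc i) ℕ.+ n) ∣
      ≡⟨ cong ∣_∣ (∑-split g (L (suc i)) n) ⟩
    ∣ ∑ g (L (suc i)) + ∑ (λ p → g (L (suc i) ℕ.+ p)) n ∣
      ≤⟨ ℚ.∣p+q∣≤∣p∣+∣q∣ (∑ g (L (suc i))) (∑ (λ p → g (L (suc i) ℕ.+ p)) n) ⟩
    ∣ ∑ g (L (suc i)) ∣ + ∣ ∑ (λ p → g (L (suc i) ℕ.+ p)) n ∣
      ≤⟨ ℚ.+-mono-≤ bound (segment-bound i (β≤ i₀≤i) (k≤ i₀≤i) n n≤) ⟩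
    ι c + ι (period i)
      ≡⟨ ι-+ c (period i) ⟨
    ι (c ℕ.+ period i) ∎
    where open ℚ.≤-Reasoning

  absorb : ∀ c i p → c ℕ.+ i ℕ.* p ℕ.+ p ≡ c ℕ.+ suc i ℕ.* p
  absorb c i p = trans (ℕ.+-assoc c (i ℕ.* p) p) (cong (c ℕ.+_) (ℕ.+-comm (i ℕ.* p) p))

  -- Everything before segment i₀ is bounded trivially by its number of positions. Each later
  -- segment adds at most its own period, which is at most the newest one.
  full-bound : ∀ d → let i = d ℕ.+ i₀ in
    ∣ ∑ g (L (suc i)) ∣ ≤ ι (L (suc i₀) ℕ.+ i ℕ.* period i)
  full-bound zero    = ℚ.≤-trans (∑-abs g (L (suc i₀)) g≤1) (ι-mono (ℕ.m≤m+n (L (suc i₀)) _))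
  full-bound (suc d) = begin
    ∣ ∑ g (L (suc (suc i))) ∣
      ≡⟨ cong (λ l → ∣ ∑ g l ∣) (Segment.L-suc i) ⟩
    ∣ ∑ g (L (suc i) ℕ.+ Segment.M i ℕ.* period i) ∣
      ≤⟨ partial-bound i _ (ℕ.m≤n+m i₀ d) ℕ.≤-refl (L (suc i₀) ℕ.+ i ℕ.* period i) (full-bound d) ⟩
    ι (L (suc i₀) ℕ.+ i ℕ.* period i ℕ.+ period i)
      ≤⟨ ι-mono (ℕ.≤-trans
           (ℕ.≤-reflexive (absorb (L (suc i₀)) i (period i)))
           (ℕ.+-monoʳ-≤ (L (suc i₀)) (ℕ.*-monoʳ-≤ (suc i) (period-mono i)))) ⟩
    ι (L (suc i₀) ℕ.+ suc i ℕ.* period (suc i)) ∎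
    where
    open ℚ.≤-Reasoning
    i = d ℕ.+ i₀

  discrepancy-bound : ∀ i → i₀ ℕ.≤ i → ∀ n → L (suc i) ℕ.≤ n → n ℕ.≤ L (suc (suc i)) →
    ∣ ι (occurrences B exampleE n) - weight exampleQ k n ∣ ≤ ι (L (suc i₀) ℕ.+ suc (suc i) ℕ.* period i)
  discrepancy-bound i i₀≤i n L≤n n≤L = begin
    ∣ ι (occurrences B exampleE n) - weight exampleQ k n ∣
      ≡⟨ cong ∣_∣ (occurrences-weight n) ⟩
    ∣ ∑ g n ∣
      ≡⟨ cong (λ n → ∣ ∑ g n ∣) (ℕ.m+[n∸m]≡n L≤n) ⟨
    ∣ ∑ g (L (suc i) ℕ.+ (n ∸ L (suc i))) ∣
      ≤⟨ partial-bound i (n ∸ L (suc i)) i₀≤i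
           (ℕ.m≤n+o⇒m∸n≤o n (L (suc i)) (subst (n ℕ.≤_) (Segment.L-suc i) n≤L))
           (L (suc i₀) ℕ.+ i ℕ.* period i)
           (subst (λ i → ∣ ∑ g (L (suc i)) ∣ ≤ ι (L (suc i₀) ℕ.+ i ℕ.* period i))
             (ℕ.m∸n+n≡m i₀≤i) (full-bound (i ∸ i₀))) ⟩
    ι (L (suc i₀) ℕ.+ i ℕ.* period i ℕ.+ period i)
      -- The factor i + 1 is relaxed to the base i + 2, the form that `next-period-negligible`
      -- takes.
      ≤⟨ ι-mono (ℕ.≤-trans
           (ℕ.≤-reflexive (absorb (L (suc i₀)) i (period i)))
           (ℕ.+-monoʳ-≤ (L (suc i₀)) (ℕ.*-monoˡ-≤ (period i) (ℕ.n≤1+n (suc i))))) ⟩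
    ι (L (suc i₀) ℕ.+ suc (suc i) ℕ.* period i) ∎
    where open ℚ.≤-Reasoning

  base≤ : ∀ {i a} → i ℕ.≤ suc a → base (suc i) ℕ.≤ suc (suc a)
  base≤ {zero}  i≤ = ℕ.s≤s (ℕ.s≤s ℕ.z≤n)
  base≤ {suc i} i≤ = ℕ.s≤s i≤

  -- A window that starts before segment i ends inside it at the latest, because k is at most the
  -- length of the segment. All its bases are therefore at most i + 2.
  weight-lower : ∀ i → i₀ ℕ.≤ i → ∀ n → L (suc i) ℕ.≤ n →
    ι (L (suc i)) * recip (suc (suc i) ^ k) {{ℕ.m^n≢0 (suc (suc i)) k}} ≤ weight exampleQ k n
  weight-lower i i₀≤i n L≤n = begin
    ι (L (suc i)) * r
      ≡⟨ ∑-const r (L (suc i)) ⟨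
    ∑ (λ _ → r) (L (suc i))
      ≤⟨ ∑-mono-≤ (L (suc i)) (λ j j< →
           recip-anti-≤ {{window-nonZero exampleQ j k}} {{ℕ.m^n≢0 (suc (suc i)) k}}
           (∏-≤ (λ t → q exampleQ (j ℕ.+ t)) (suc (suc i)) k λ t t<k →
             base≤ (locate-≤ (subst (j ℕ.+ t ℕ.<_) (sym (Segment.L-suc i))
               (ℕ.+-mono-<-≤ j< (ℕ.≤-trans (ℕ.<⇒≤ t<k) k≤length)))))) ⟩
    weight exampleQ k (L (suc i))
      ≤⟨ ∑-monoʳ-≤ (λ j → over-nonNeg 1 exampleQ j k) L≤n ⟩
    weight exampleQ k n ∎
    where
    open ℚ.≤-Reasoning
    r = recip (suc (suc i) ^ k) {{ℕ.m^n≢0 (suc (suc i)) k}}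
    k≤length : k ℕ.≤ Segment.M i ℕ.* period i
    k≤length = ℕ.≤-trans (k≤ i₀≤i) (ℕ.≤-trans (ℕ.<⇒≤ (Segment.i<w i))
      (ℕ.≤-trans (Segment.w≤period i) (Segment.period≤length i)))

  weight-pos : ∀ n → 0ℚ < weight exampleQ k (suc n)
  weight-pos n = ℚ.+-mono-≤-< (∑-nonNeg (λ j → over 1 exampleQ j k) (λ j → over-nonNeg 1 exampleQ j k) n)
    (ℚ.positive⁻¹ _ {{ℚ.normalize-pos 1 (window exampleQ n k) {{window-nonZero exampleQ n k}}}})

  normalityRatio-bound : ∀ m .{{_ : NonZero m}} {ε} → recip m < ε → ∀ i →
    m ℕ.* (suc (suc (suc i)) ^ k ℕ.* (L (suc i₀) ℕ.+ suc (suc (suc i)) ℕ.* period (suc i)))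
      ℕ.≤ Segment.M i ℕ.* period i →
    i₀ ℕ.≤ suc i → ∀ n → L (suc (suc i)) ℕ.≤ n → n ℕ.< L (suc (suc (suc i))) →
    ∣ normalityRatio exampleQ B exampleE n - 1ℚ ∣ < ε
  normalityRatio-bound m {{m≢0}} {ε} recip-m<ε i growth i₀≤ n lower upper =
    ∣p÷q-1∣<ε (ι (occurrences B exampleE (suc n))) W {{weight-nonZero exampleQ k n}} (weight-pos n)
      (begin-strict
      ∣ ι (occurrences B exampleE (suc n)) - W ∣
        -- The ratio with index n involves the first n + 1 positions, and n < L (i+3) still leaves n
        -- + 1 within the range of the bound.
        ≤⟨ discrepancy-bound (suc i) i₀≤ (suc n) (ℕ.m≤n⇒m≤1+n lower) upper ⟩
      ι (L (suc i₀) ℕ.+ a ℕ.* period (suc i))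
        ≤⟨ ι≤recip* {m} {a ^ k} {L (suc i₀) ℕ.+ a ℕ.* period (suc i)} {L (suc (suc i))} {W}
             {{m≢0}} {{ℕ.m^n≢0 a k}}
             -- L (i+2) is estimated from below by its last segment alone.
             (ℕ.≤-trans growth (subst (Segment.M i ℕ.* period i ℕ.≤_) (sym (Segment.L-suc i))
               (ℕ.m≤n+m (Segment.M i ℕ.* period i) (L (suc i)))))
             (weight-lower (suc i) i₀≤ (suc n) (ℕ.m≤n⇒m≤1+n lower)) ⟩
      recip m * W
        <⟨ ℚ.*-monoˡ-<-pos W {{ℚ.positive (weight-pos n)}} recip-m<ε ⟩
      ε * W ∎)
    where
    open ℚ.≤-Reasoning
    a = suc (suc (suc i))
    W = weight exampleQ k (suc n)

  normalityRatio⟶1 : normalityRatio exampleQ B exampleE ⟶ 1ℚ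
  normalityRatio⟶1 ε 0<ε = limit (next-period-negligible m k (L (suc i₀)))
    where
    -- A positive ε is at least 1 over its denominator, hence larger than 1/m.
    m = suc (ℚ.denominatorℕ ε)
    recip-m<ε : recip m < ε
    recip-m<ε = CantorSeries.1/p<ε exampleQ exampleE E<q m ε {{_}}
      {{ℚ.positive 0<ε}} (ℕ.n<1+n (ℚ.denominatorℕ ε))
    limit : (∃ λ A → ∀ i → A ℕ.≤ i →
              m ℕ.* (suc (suc (suc i)) ^ k ℕ.* (L (suc i₀) ℕ.+ suc (suc (suc i)) ℕ.* period (suc i)))
                ℕ.≤ Segment.M i ℕ.* period i) →
            ∃ λ N → ∀ n → N ℕ.≤ n → ∣ normalityRatio exampleQ B exampleE n - 1ℚ ∣ < ε
    -- Beyond this threshold the location index has the form i + 2 with i ≥ A + i₀, so segment i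
    -- precedes the current one and the growth estimate applies.
    limit (A , growth) = L (suc (suc (A ℕ.+ i₀))) , λ n N≤n → close n (locate n) (locate-≥ N≤n)
      where
      close : ∀ n (loc : Location n) → suc (suc (A ℕ.+ i₀)) ℕ.≤ Location.i loc →
              ∣ normalityRatio exampleQ B exampleE n - 1ℚ ∣ < ε
      close n record { i = suc (suc i) ; lower = lower ; upper = upper } (ℕ.s≤s (ℕ.s≤s A+i₀≤i)) =
        normalityRatio-bound m recip-m<ε i (growth i (ℕ.≤-trans (ℕ.m≤m+n A i₀) A+i₀≤i))
          (ℕ.m≤n⇒m≤1+n (ℕ.≤-trans (ℕ.m≤n+m i₀ A) A+i₀≤i)) n lower upper

-- The real number exampleX

½*ε+½*ε : ∀ ε → ½ * ε + ½ * ε ≡ ε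
½*ε+½*ε ε = trans (sym (ℚ.*-distribʳ-+ ε ½ ½)) (ℚ.*-identityˡ ε)

-- The Cauchy condition is used with ε/2; the other half of ε is the positive gap that `_<ᴿ_` asks
-- for.
approx-converges : ∀ x → ConvergesTo (approx x) x
approx-converges x ε 0<ε with cauchy x (½ * ε) 0<½ε
  where
  0<½ε : 0ℚ < ½ * ε
  0<½ε = ℚ.positive⁻¹ (½ * ε) {{ℚ.pos*pos⇒pos ½ ε {{ℚ.positive 0<ε}}}}
... | N , close = N , λ n N≤n →
  (½ * ε , 0<½ε , N , λ m N≤m → begin
    s n - ε + ½ * ε
      ≡⟨ cong (λ e → s n - e + ½ * ε) (½*ε+½*ε ε) ⟨
    s n - (½ * ε + ½ * ε) + ½ * ε
      ≡⟨ regroup (s n) (s m) (½ * ε) ⟩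
    s m + (s n - s m - ½ * ε)
      ≤⟨ ℚ.+-monoʳ-≤ (s m) (p-q≤0 (ℚ.≤-trans (p≤∣p∣ (s n - s m)) (ℚ.<⇒≤ (close n m N≤n N≤m)))) ⟩
    s m + 0ℚ
      ≡⟨ ℚ.+-identityʳ (s m) ⟩
    s m ∎) ,
  (½ * ε , 0<½ε , N , λ m N≤m → begin
    s m + ½ * ε
      ≡⟨ regroup′ (s m) (s n) (½ * ε) ⟩
    s n + (s m - s n + ½ * ε)
      ≤⟨ ℚ.+-monoʳ-≤ (s n) (ℚ.+-monoˡ-≤ (½ * ε)
           (ℚ.≤-trans (p≤∣p∣ (s m - s n)) (ℚ.<⇒≤ (close m n N≤m N≤n)))) ⟩
    s n + (½ * ε + ½ * ε)
      ≡⟨ cong (s n +_) (½*ε+½*ε ε) ⟩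
    s n + ε ∎)
  where
  open ℚ.≤-Reasoning
  s = approx x
  0<½ε : 0ℚ < ½ * ε
  0<½ε = ℚ.positive⁻¹ (½ * ε) {{ℚ.pos*pos⇒pos ½ ε {{ℚ.positive 0<ε}}}}
  p-q≤0 : ∀ {p q} → p ≤ q → p - q ≤ 0ℚ
  p-q≤0 {p} {q} p≤q = subst (p - q ≤_) (ℚ.+-inverseʳ q) (ℚ.+-monoˡ-≤ (- q) p≤q)
  p≤∣p∣ : ∀ p → p ≤ ∣ p ∣
  p≤∣p∣ p with ℚ.≤-total 0ℚ p
  ... | inj₁ 0≤p = ℚ.≤-reflexive (sym (ℚ.0≤p⇒∣p∣≡p 0≤p))
  ... | inj₂ p≤0 = ℚ.≤-trans p≤0 (ℚ.0≤∣p∣ p)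
  regroup : ∀ x y e → x - (e + e) + e ≡ y + (x - y - e)
  regroup = Ring.solve-∀ ℚ-ring
  regroup′ : ∀ x y e → x + e ≡ y + (x - y + e)
  regroup′ = Ring.solve-∀ ℚ-ring

m≤L[1+m] : ∀ m → m ℕ.≤ L (suc m)
m≤L[1+m] zero    = ℕ.z≤n
m≤L[1+m] (suc m) = ℕ.≤-trans (ℕ.s≤s (m≤L[1+m] m)) (L-increasing m)

-- The origin of segment m lies at or beyond m and carries the digit 0, whereas the maximal digit
-- there is m + 1.
nonterminating : ∀ m → ∃ λ n → m ℕ.≤ n × exampleE n ≢ q exampleQ n ∸ 1
nonterminating m = L (suc m) ℕ.+ 0 , ℕ.≤-trans (m≤L[1+m] m) (ℕ.m≤m+n _ 0) ,
  λ eq → ℕ.0≢1+n (trans (sym (Segment.E-start m))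
    (trans eq (cong (_∸ 1) (Segment.q-segment m (Segment.0<length m)))))

0≤exampleX : fromℚ 0ℚ ≤ᴿ exampleX
0≤exampleX (δ , 0<δ , N , below) = ℚ.<-irrefl refl (ℚ.<-≤-trans
  (ℚ.+-mono-≤-<
    (∑-nonNeg (λ n → over (exampleE n) exampleQ 0 (suc n))
      (λ n → over-nonNeg (exampleE n) exampleQ 0 (suc n)) N)
    0<δ)
  (below N ℕ.≤-refl))

-- The first digit is 0 and the first base is 2, so all partial sums from the first on are at most 0
-- + 1/2, which leaves the gap 1/2.
exampleX<1 : exampleX <ᴿ fromℚ 1ℚ
exampleX<1 = ½ , ℚ.positive⁻¹ ½ , 1 , λ n 1≤n →
  ℚ.+-monoˡ-≤ ½ (ℚ.≤-trans (proj₂ (CantorSeries.sandwich exampleQ exampleE E<q 1 n 1≤n)) u₁≤½)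
  where
  u₁≤½ : CantorSeries.u exampleQ exampleE E<q 1 ≤ ½
  u₁≤½ = ℚ.≤-reflexive (cong (λ e → 0ℚ + over e exampleQ 0 1 + over 1 exampleQ 0 1) (Segment.E-start 0))

theorem4p3 : Normal exampleQ exampleX
theorem4p3 k 1≤k = record
  { 0≤x    = 0≤exampleX
  ; x<1    = exampleX<1
  ; normal = exampleE
           , record { digit<q = E<q ; nonterminal = nonterminating ; converges = approx-converges exampleX }
           , λ b B → normalityRatio⟶1 B
  }
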